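{- Let $D=(V_1\cup V_2,E)$ be a bipartite digraph with all edges oriented from $V_1$ to $V_2$, with maximum in-degree $\Delta^-\ge 1$ and maximum out-degree $\Delta^+$. Let $a,b,c\in\mathbb{N}$ be integers and $\delta>0$ be a real parameter such that $a\ge b\ge 32|V_1|$ and $$\delta\le \frac{\left(2^{ -1/2}\,\frac{b}{a}\right)^{\Delta^- }}{4\Delta^+\Delta^- }.$$ Let $T$ be a tournament and let $A,B\subseteq V(T)$ be subsets of its vertices such that $|A|=a$ and for all but at most a $\delta$-fraction of the subsets $S\subseteq A$ of size $\Delta^-$ we have $|N_T^+(S)\cap B|\ge c$. Let $f:V_1\to 2^A$ be a function such that $|f(v)|\ge b$ for each $v\in V_1$. Then there exists an injective function $\phi:V_1\to A$ such that for each $v\in V_1$ we have $\phi(v)\in f(v)$, and for each $u\in V_2$ we have $|N_T^+(\phi(N_D^-(u)))\cap B|\ge c$.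
   Context: A tournament is an orientation of the edges of a finite complete graph. $2^A$ denotes the set of all subsets of $A$. For a vertex $u$ of a digraph $D$, $N_D^-(u)$ is its in-neighborhood. For a set $S$ of vertices of $T$, $N_T^+(S)$ denotes the common out-neighborhood of $S$, i.e. the set of vertices of $T$ that are out-neighbors of every vertex of $S$ (so $N_T^+(\varnothing)=V(T)$). -}

module Defs where

open import Data.Fin.Base using (Fin)
open import Data.Fin.Properties using (any?; all?) renaming (_≟_ to _≟ᶠ_)
open import Data.Fin.Subset using (Subset; inside; outside; ∣_∣)
open import Data.Fin.Subset.Properties using (_∈?_; _⊆?_)
open import Data.Integer.Base as ℤ using (+_)
import Data.Integer.Properties as ℤₚ
open import Data.List.Base as List using (List; length; filter; foldr; allFin; _++_)
open import Data.Nat.Base as ℕ using (ℕ; zero; suc)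
import Data.Nat.Properties as ℕₚ
open import Data.Nat.Solver using (module +-*-Solver)
open import Data.Product.Base using (∃-syntax; _×_; _,_)
open import Data.Rational.Base as ℚ using (ℚ; mkℚ; 0ℚ; 1ℚ; ½; toℚᵘ)
import Data.Rational.Properties as ℚₚ
import Data.Rational.Solver as ℚSolver
open import Data.Rational.Unnormalised.Base as ℚᵘ using (mkℚᵘ)
import Data.Rational.Unnormalised.Properties as ℚᵘₚ
open import Data.Sum.Base using (_⊎_; inj₁; inj₂)
open import Data.Vec.Base using (_∷_; []; tabulate)
open import Function.Base using (_∘_)
open import Level using (Level; 0ℓ)
open import Relation.Binary.Core using (Rel; REL)
import Relation.Binary.Definitions as B
open import Relation.Binary.PropositionalEquality
open import Relation.Nullary.Decidable using (yes; no; does; ¬?; _×-dec_; _→-dec_)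
open import Relation.Nullary.Negation using (¬_; contradiction)
open import Relation.Unary using (Pred; Decidable)

private
  variable
    ℓ : Level
    m k n : ℕ

-- Real numbers as Cauchy sequences of rationals; two sequences denote the
-- same real when each is ≤ʳ the other.

record ℝ : Set where
  constructor mkℝ
  field
    seq    : ℕ → ℚ
    cauchy : ∀ ε → 0ℚ ℚ.< ε →
             ∃[ N ] ∀ i j → N ℕ.≤ i → N ℕ.≤ j → ℚ.∣ seq i ℚ.- seq j ∣ ℚ.≤ ε

open ℝ public

infix 4 _≤ʳ_ _<ʳ_ _≈ʳ_

_≤ʳ_ : ℝ → ℝ → Set
x ≤ʳ y = ∀ ε → 0ℚ ℚ.< ε → ∃[ N ] ∀ i → N ℕ.≤ i → seq x i ℚ.≤ seq y i ℚ.+ ε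

_<ʳ_ : ℝ → ℝ → Set
x <ʳ y = ∃[ ε ] 0ℚ ℚ.< ε × ∃[ N ] ∀ i → N ℕ.≤ i → seq x i ℚ.+ ε ℚ.≤ seq y i

_≈ʳ_ : ℝ → ℝ → Set
x ≈ʳ y = x ≤ʳ y × y ≤ʳ x

fromℚ : ℚ → ℝ
fromℚ q = mkℝ (λ _ → q) λ ε 0<ε → 0 , λ _ _ _ _ →
  subst (ℚ._≤ ε) (cong ℚ.∣_∣ (sym (ℚₚ.+-inverseʳ q))) (ℚₚ.<⇒≤ 0<ε)

fromℕ : ℕ → ℝ
fromℕ p = fromℚ (+ p ℚ./ 1)

private
  ∣p∣-nonNeg : ∀ p → 0ℚ ℚ.≤ ℚ.∣ p ∣
  ∣p∣-nonNeg p = ℚₚ.nonNegative⁻¹ ℚ.∣ p ∣ {{ℚₚ.∣-∣-nonNeg p}}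

  *-mono-≤ : ∀ {p q r s} → 0ℚ ℚ.≤ r → 0ℚ ℚ.≤ q → p ℚ.≤ q → r ℚ.≤ s →
             p ℚ.* r ℚ.≤ q ℚ.* s
  *-mono-≤ {p} {q} {r} {s} 0≤r 0≤q p≤q r≤s = ℚₚ.≤-trans
    (ℚₚ.*-monoʳ-≤-nonNeg r {{ℚ.nonNegative 0≤r}} p≤q)
    (ℚₚ.*-monoˡ-≤-nonNeg q {{ℚ.nonNegative 0≤q}} r≤s)

  bounded : ∀ x → ∃[ M ] 0ℚ ℚ.< M × ∃[ N ] ∀ i → N ℕ.≤ i → ℚ.∣ seq x i ∣ ℚ.≤ M
  bounded x with N , close ← cauchy x 1ℚ (ℚₚ.positive⁻¹ 1ℚ) =
    1ℚ ℚ.+ ℚ.∣ seq x N ∣ ,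
    ℚₚ.+-mono-<-≤ (ℚₚ.positive⁻¹ 1ℚ) (∣p∣-nonNeg (seq x N)) ,
    N , λ i N≤i → begin
      ℚ.∣ seq x i ∣                                  ≡⟨ cong ℚ.∣_∣ (split (seq x i) (seq x N)) ⟩
      ℚ.∣ (seq x i ℚ.- seq x N) ℚ.+ seq x N ∣        ≤⟨ ℚₚ.∣p+q∣≤∣p∣+∣q∣ (seq x i ℚ.- seq x N) (seq x N) ⟩
      ℚ.∣ seq x i ℚ.- seq x N ∣ ℚ.+ ℚ.∣ seq x N ∣    ≤⟨ ℚₚ.+-monoˡ-≤ ℚ.∣ seq x N ∣ (close i N N≤i ℕₚ.≤-refl) ⟩
      1ℚ ℚ.+ ℚ.∣ seq x N ∣                           ∎
    where
    open ℚₚ.≤-Reasoning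
    split : ∀ p q → p ≡ (p ℚ.- q) ℚ.+ q
    split = solve 2 (λ p q → p := (p :- q) :+ q) refl
      where open ℚSolver.+-*-Solver

  share : ∀ ε M → 0ℚ ℚ.< ε → 0ℚ ℚ.< M → ∃[ η ] 0ℚ ℚ.< η × M ℚ.* η ≡ ½ ℚ.* ε
  share ε M 0<ε 0<M = ½ε ℚ.* M⁻¹ , 0<η , eq
    where
    instance
      M≢0 : ℚ.NonZero M
      M≢0 = ℚₚ.pos⇒nonZero M {{ℚ.positive 0<M}}
    ½ε M⁻¹ : ℚ
    ½ε = ½ ℚ.* ε
    M⁻¹ = ℚ.1/ M
    0<½ε : 0ℚ ℚ.< ½ε
    0<½ε = subst (ℚ._< ½ε) (ℚₚ.*-zeroʳ ½) (ℚₚ.*-monoʳ-<-pos ½ 0<ε)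
    0<η : 0ℚ ℚ.< ½ε ℚ.* M⁻¹
    0<η = subst (ℚ._< ½ε ℚ.* M⁻¹) (ℚₚ.*-zeroˡ M⁻¹)
      (ℚₚ.*-monoˡ-<-pos M⁻¹ {{ℚₚ.1/pos⇒pos M {{ℚ.positive 0<M}}}} 0<½ε)
    eq : M ℚ.* (½ε ℚ.* M⁻¹) ≡ ½ε
    eq = begin
      M ℚ.* (½ε ℚ.* M⁻¹)  ≡⟨ solve 3 (λ a b c → a :* (b :* c) := b :* (a :* c)) refl M ½ε M⁻¹ ⟩
      ½ε ℚ.* (M ℚ.* M⁻¹)  ≡⟨ cong (½ε ℚ.*_) (ℚₚ.*-inverseʳ M) ⟩
      ½ε ℚ.* 1ℚ           ≡⟨ ℚₚ.*-identityʳ ½ε ⟩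
      ½ε                  ∎
      where open ≡-Reasoning
            open ℚSolver.+-*-Solver

  halves : ∀ ε → ½ ℚ.* ε ℚ.+ ½ ℚ.* ε ≡ ε
  halves ε = trans (sym (ℚₚ.*-distribʳ-+ ε ½ ½)) (ℚₚ.*-identityˡ ε)

  product-close : ∀ {ε X Y η θ} a b c d → 0ℚ ℚ.< X → 0ℚ ℚ.< Y →
    ℚ.∣ a ∣ ℚ.≤ X → ℚ.∣ d ∣ ℚ.≤ Y → ℚ.∣ b ℚ.- d ∣ ℚ.≤ η → ℚ.∣ a ℚ.- c ∣ ℚ.≤ θ →
    X ℚ.* η ≡ ½ ℚ.* ε → Y ℚ.* θ ≡ ½ ℚ.* ε → ℚ.∣ a ℚ.* b ℚ.- c ℚ.* d ∣ ℚ.≤ ε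
  product-close {ε} {X} {Y} {η} {θ} a b c d 0<X 0<Y a≤X d≤Y b-d≤η a-c≤θ Xη Yθ = begin
    ℚ.∣ a ℚ.* b ℚ.- c ℚ.* d ∣
      ≡⟨ cong ℚ.∣_∣ (expand a b c d) ⟩
    ℚ.∣ a ℚ.* (b ℚ.- d) ℚ.+ d ℚ.* (a ℚ.- c) ∣
      ≤⟨ ℚₚ.∣p+q∣≤∣p∣+∣q∣ (a ℚ.* (b ℚ.- d)) (d ℚ.* (a ℚ.- c)) ⟩
    ℚ.∣ a ℚ.* (b ℚ.- d) ∣ ℚ.+ ℚ.∣ d ℚ.* (a ℚ.- c) ∣
      ≡⟨ cong₂ ℚ._+_ (ℚₚ.∣p*q∣≡∣p∣*∣q∣ a (b ℚ.- d)) (ℚₚ.∣p*q∣≡∣p∣*∣q∣ d (a ℚ.- c)) ⟩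
    ℚ.∣ a ∣ ℚ.* ℚ.∣ b ℚ.- d ∣ ℚ.+ ℚ.∣ d ∣ ℚ.* ℚ.∣ a ℚ.- c ∣
      ≤⟨ ℚₚ.+-mono-≤
           (*-mono-≤ (∣p∣-nonNeg (b ℚ.- d)) (ℚₚ.<⇒≤ 0<X) a≤X b-d≤η)
           (*-mono-≤ (∣p∣-nonNeg (a ℚ.- c)) (ℚₚ.<⇒≤ 0<Y) d≤Y a-c≤θ) ⟩
    X ℚ.* η ℚ.+ Y ℚ.* θ
      ≡⟨ cong₂ ℚ._+_ Xη Yθ ⟩
    ½ ℚ.* ε ℚ.+ ½ ℚ.* ε
      ≡⟨ halves ε ⟩
    ε ∎
    where
    open ℚₚ.≤-Reasoning
    expand : ∀ a b c d → a ℚ.* b ℚ.- c ℚ.* d ≡ a ℚ.* (b ℚ.- d) ℚ.+ d ℚ.* (a ℚ.- c)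
    expand = solve 4 (λ a b c d → a :* b :- c :* d := a :* (b :- d) :+ d :* (a :- c)) refl
      where open ℚSolver.+-*-Solver

infixl 7 _*ʳ_ _/ʳ_
infixr 8 _^ʳ_

_*ʳ_ : ℝ → ℝ → ℝ
x *ʳ y = mkℝ (λ i → seq x i ℚ.* seq y i) close
  where
  close : ∀ ε → 0ℚ ℚ.< ε → ∃[ N ] ∀ i j → N ℕ.≤ i → N ℕ.≤ j →
          ℚ.∣ seq x i ℚ.* seq y i ℚ.- seq x j ℚ.* seq y j ∣ ℚ.≤ ε
  close ε 0<ε =
    let X , 0<X , N₁ , x≤X = bounded x
        Y , 0<Y , N₂ , y≤Y = bounded y
        η , 0<η , Xη = share ε X 0<ε 0<X
        θ , 0<θ , Yθ = share ε Y 0<ε 0<Y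
        N₃ , closeʸ = cauchy y η 0<η
        N₄ , closeˣ = cauchy x θ 0<θ
    in N₁ ℕ.⊔ N₂ ℕ.⊔ (N₃ ℕ.⊔ N₄) , λ i j N≤i N≤j →
       product-close (seq x i) (seq y i) (seq x j) (seq y j) 0<X 0<Y
         (x≤X i (ℕₚ.m⊔n≤o⇒m≤o N₁ N₂ (ℕₚ.m⊔n≤o⇒m≤o (N₁ ℕ.⊔ N₂) (N₃ ℕ.⊔ N₄) N≤i)))
         (y≤Y j (ℕₚ.m⊔n≤o⇒n≤o N₁ N₂ (ℕₚ.m⊔n≤o⇒m≤o (N₁ ℕ.⊔ N₂) (N₃ ℕ.⊔ N₄) N≤j)))
         (closeʸ i j
           (ℕₚ.m⊔n≤o⇒m≤o N₃ N₄ (ℕₚ.m⊔n≤o⇒n≤o (N₁ ℕ.⊔ N₂) (N₃ ℕ.⊔ N₄) N≤i))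
           (ℕₚ.m⊔n≤o⇒m≤o N₃ N₄ (ℕₚ.m⊔n≤o⇒n≤o (N₁ ℕ.⊔ N₂) (N₃ ℕ.⊔ N₄) N≤j)))
         (closeˣ i j
           (ℕₚ.m⊔n≤o⇒n≤o N₃ N₄ (ℕₚ.m⊔n≤o⇒n≤o (N₁ ℕ.⊔ N₂) (N₃ ℕ.⊔ N₄) N≤i))
           (ℕₚ.m⊔n≤o⇒n≤o N₃ N₄ (ℕₚ.m⊔n≤o⇒n≤o (N₁ ℕ.⊔ N₂) (N₃ ℕ.⊔ N₄) N≤j)))
         Xη Yθ

_^ʳ_ : ℝ → ℕ → ℝ
x ^ʳ zero  = fromℕ 1
x ^ʳ suc p = x *ʳ x ^ʳ p

-- x /ʳ 0 is the junk value 0.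
_/ʳ_ : ℝ → ℕ → ℝ
x /ʳ zero  = fromℕ 0
x /ʳ suc p = x *ʳ fromℚ (+ 1 ℚ./ suc p)

-- root₂ i = ⌊ i / √2 ⌋, the largest r ≤ i with 2r² ≤ i².

searchRoot₂ : ℕ → ℕ → ℕ
searchRoot₂ i zero    = 0
searchRoot₂ i (suc r) with 2 ℕ.* (suc r ℕ.* suc r) ℕₚ.≤? i ℕ.* i
... | yes _ = suc r
... | no  _ = searchRoot₂ i r

root₂ : ℕ → ℕ
root₂ i = searchRoot₂ i i

private
  searchRoot₂-lower : ∀ i r → 2 ℕ.* (searchRoot₂ i r ℕ.* searchRoot₂ i r) ℕ.≤ i ℕ.* i
  searchRoot₂-lower i zero    = ℕ.z≤n
  searchRoot₂-lower i (suc r) with 2 ℕ.* (suc r ℕ.* suc r) ℕₚ.≤? i ℕ.* i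
  ... | yes p = p
  ... | no  _ = searchRoot₂-lower i r

  searchRoot₂-upper : ∀ i r → i ℕ.* i ℕ.< 2 ℕ.* (suc r ℕ.* suc r) →
    i ℕ.* i ℕ.< 2 ℕ.* (suc (searchRoot₂ i r) ℕ.* suc (searchRoot₂ i r))
  searchRoot₂-upper i zero    p = p
  searchRoot₂-upper i (suc r) p with 2 ℕ.* (suc r ℕ.* suc r) ℕₚ.≤? i ℕ.* i
  ... | yes _ = p
  ... | no  q = searchRoot₂-upper i r (ℕₚ.≰⇒> q)

root₂-lower : ∀ i → 2 ℕ.* (root₂ i ℕ.* root₂ i) ℕ.≤ i ℕ.* i
root₂-lower i = searchRoot₂-lower i i

root₂-upper : ∀ i → i ℕ.* i ℕ.< 2 ℕ.* (suc (root₂ i) ℕ.* suc (root₂ i))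
root₂-upper i = searchRoot₂-upper i i (ℕₚ.<-≤-trans
  (ℕₚ.*-mono-< (ℕₚ.n<1+n i) (ℕₚ.n<1+n i)) (ℕₚ.m≤n*m (suc i ℕ.* suc i) 2))

private
  -- root₂ i / i ≤ 1/√2 < (root₂ j + 1) / j
  root₂-cross : ∀ i j → root₂ i ℕ.* j ℕ.≤ suc (root₂ j) ℕ.* i
  root₂-cross i j with root₂ i ℕ.* j ℕₚ.≤? suc (root₂ j) ℕ.* i
  ... | yes h = h
  ... | no  h = contradiction (begin-strict
      2 ℕ.* ((q ℕ.* i) ℕ.* (q ℕ.* i))  <⟨ ℕₚ.*-monoʳ-< 2 (ℕₚ.*-mono-< (ℕₚ.≰⇒> h) (ℕₚ.≰⇒> h)) ⟩
      2 ℕ.* ((p ℕ.* j) ℕ.* (p ℕ.* j))  ≡⟨ regroup p j ⟩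
      2 ℕ.* (p ℕ.* p) ℕ.* (j ℕ.* j)    ≤⟨ ℕₚ.*-mono-≤ (root₂-lower i) (ℕₚ.<⇒≤ (root₂-upper j)) ⟩
      (i ℕ.* i) ℕ.* (2 ℕ.* (q ℕ.* q))  ≡⟨ ℕₚ.*-comm (i ℕ.* i) (2 ℕ.* (q ℕ.* q)) ⟩
      2 ℕ.* (q ℕ.* q) ℕ.* (i ℕ.* i)    ≡⟨ sym (regroup q i) ⟩
      2 ℕ.* ((q ℕ.* i) ℕ.* (q ℕ.* i))  ∎) (ℕₚ.<-irrefl refl)
    where
    open ℕₚ.≤-Reasoning
    p q : ℕ
    p = root₂ i
    q = suc (root₂ j)
    regroup : ∀ a b → 2 ℕ.* ((a ℕ.* b) ℕ.* (a ℕ.* b)) ≡ 2 ℕ.* (a ℕ.* a) ℕ.* (b ℕ.* b)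
    regroup = solve 2 (λ a b → con 2 :* ((a :* b) :* (a :* b)) := con 2 :* (a :* a) :* (b :* b)) refl
      where open +-*-Solver

  frac : ℕ → ℕ → ℚ
  frac p i = + p ℚ./ suc i

  frac-≤ : ∀ {p q i j} → p ℕ.* suc j ℕ.≤ q ℕ.* suc i → frac p i ℚ.≤ frac q j
  frac-≤ {p} {q} {i} {j} h = ℚₚ.toℚᵘ-cancel-≤
    (ℚᵘₚ.≤-respˡ-≃ (ℚᵘₚ.≃-sym (ℚₚ.toℚᵘ-fromℚᵘ (mkℚᵘ (+ p) i)))
    (ℚᵘₚ.≤-respʳ-≃ (ℚᵘₚ.≃-sym (ℚₚ.toℚᵘ-fromℚᵘ (mkℚᵘ (+ q) j)))
    (ℚᵘ.*≤* (subst₂ ℤ._≤_ (ℤₚ.pos-* p (suc j)) (ℤₚ.pos-* q (suc i)) (ℤ.+≤+ h)))))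

  frac-+ : ∀ p q i → frac p i ℚ.+ frac q i ≡ frac (p ℕ.+ q) i
  frac-+ p q i = ℚₚ.toℚᵘ-injective (begin
    toℚᵘ (frac p i ℚ.+ frac q i)          ≈⟨ ℚₚ.toℚᵘ-homo-+ (frac p i) (frac q i) ⟩
    toℚᵘ (frac p i) ℚᵘ.+ toℚᵘ (frac q i)  ≈⟨ ℚᵘₚ.+-cong (ℚₚ.toℚᵘ-fromℚᵘ (mkℚᵘ (+ p) i)) (ℚₚ.toℚᵘ-fromℚᵘ (mkℚᵘ (+ q) i)) ⟩
    mkℚᵘ (+ p) i ℚᵘ.+ mkℚᵘ (+ q) i        ≈⟨ ℚᵘ.*≡* (trans (cong (ℤ._* + suc i) (sym (ℤₚ.*-distribʳ-+ (+ suc i) (+ p) (+ q)))) (ℤₚ.*-assoc (+ (p ℕ.+ q)) (+ suc i) (+ suc i))) ⟩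
    mkℚᵘ (+ (p ℕ.+ q)) i                  ≈⟨ ℚᵘₚ.≃-sym (ℚₚ.toℚᵘ-fromℚᵘ (mkℚᵘ (+ (p ℕ.+ q)) i)) ⟩
    toℚᵘ (frac (p ℕ.+ q) i)               ∎)
    where open ℚᵘₚ.≃-Reasoning

  frac-* : ∀ p q i j → frac p i ℚ.* frac q j ≡ frac (p ℕ.* q) (j ℕ.+ i ℕ.* suc j)
  frac-* p q i j = ℚₚ.toℚᵘ-injective (begin
    toℚᵘ (frac p i ℚ.* frac q j)          ≈⟨ ℚₚ.toℚᵘ-homo-* (frac p i) (frac q j) ⟩
    toℚᵘ (frac p i) ℚᵘ.* toℚᵘ (frac q j)  ≈⟨ ℚᵘₚ.*-cong (ℚₚ.toℚᵘ-fromℚᵘ (mkℚᵘ (+ p) i)) (ℚₚ.toℚᵘ-fromℚᵘ (mkℚᵘ (+ q) j)) ⟩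
    mkℚᵘ (+ p) i ℚᵘ.* mkℚᵘ (+ q) j        ≈⟨ ℚᵘ.*≡* (cong (ℤ._* + (suc i ℕ.* suc j)) (sym (ℤₚ.pos-* p q))) ⟩
    mkℚᵘ (+ (p ℕ.* q)) (j ℕ.+ i ℕ.* suc j) ≈⟨ ℚᵘₚ.≃-sym (ℚₚ.toℚᵘ-fromℚᵘ (mkℚᵘ (+ (p ℕ.* q)) (j ℕ.+ i ℕ.* suc j))) ⟩
    toℚᵘ (frac (p ℕ.* q) (j ℕ.+ i ℕ.* suc j)) ∎)
    where open ℚᵘₚ.≃-Reasoning

  archimedean : ∀ p ε → 0ℚ ℚ.< ε → ∃[ N ] ∀ i → N ℕ.≤ i → frac p i ℚ.≤ ε
  archimedean p ε@(mkℚ (+ suc a) d _) 0<ε = p ℕ.* suc d , λ i N≤i →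
    subst (frac p i ℚ.≤_) (ℚₚ.fromℚᵘ-toℚᵘ ε) (frac-≤ {p} {suc a} {i} {d}
      (ℕₚ.≤-trans N≤i (ℕₚ.≤-trans (ℕₚ.n≤1+n i) (ℕₚ.m≤n*m (suc i) (suc a)))))
  archimedean p (mkℚ (+ 0) d _)      (ℚ.*<* (ℤ.+<+ ()))
  archimedean p (mkℚ ℤ.-[1+ _ ] d _) (ℚ.*<* ())

  +-cancel : ∀ a b → (a ℚ.+ b) ℚ.- b ≡ a
  +-cancel = solve 2 (λ a b → (a :+ b) :- b := a) refl
    where open ℚSolver.+-*-Solver

  neg-minus : ∀ a b → ℚ.- (a ℚ.- b) ≡ b ℚ.- a
  neg-minus = solve 2 (λ a b → :- (a :- b) := b :- a) refl
    where open ℚSolver.+-*-Solver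

  ∣-∣-≤ : ∀ {ε} a b → a ℚ.- b ℚ.≤ ε → b ℚ.- a ℚ.≤ ε → ℚ.∣ a ℚ.- b ∣ ℚ.≤ ε
  ∣-∣-≤ {ε} a b p q with ℚₚ.∣p∣≡p∨∣p∣≡-p (a ℚ.- b)
  ... | inj₁ e = subst (ℚ._≤ ε) (sym e) p
  ... | inj₂ e = subst (ℚ._≤ ε) (sym (trans e (neg-minus a b))) q

2⁻¹ᐟ² : ℝ
2⁻¹ᐟ² = mkℝ approx close
  where
  approx : ℕ → ℚ
  approx i = + root₂ (suc i) ℚ./ suc i

  gap : ∀ i j → approx i ℚ.- approx j ℚ.≤ frac 1 j
  gap i j = begin
    approx i ℚ.- approx j                           ≤⟨ ℚₚ.+-monoˡ-≤ (ℚ.- approx j) (frac-≤ {root₂ (suc i)} {suc (root₂ (suc j))} {i} {j} (root₂-cross (suc i) (suc j))) ⟩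
    frac (suc (root₂ (suc j))) j ℚ.- approx j       ≡⟨ cong (ℚ._- approx j) (sym (frac-+ 1 (root₂ (suc j)) j)) ⟩
    (frac 1 j ℚ.+ approx j) ℚ.- approx j            ≡⟨ +-cancel (frac 1 j) (approx j) ⟩
    frac 1 j                                        ∎
    where open ℚₚ.≤-Reasoning

  close : ∀ ε → 0ℚ ℚ.< ε →
          ∃[ N ] ∀ i j → N ℕ.≤ i → N ℕ.≤ j → ℚ.∣ approx i ℚ.- approx j ∣ ℚ.≤ ε
  close ε 0<ε =
    let N , small = archimedean 1 ε 0<ε
    in N , λ i j N≤i N≤j → ∣-∣-≤ (approx i) (approx j)
         (ℚₚ.≤-trans (gap i j) (small j N≤j)) (ℚₚ.≤-trans (gap j i) (small i N≤i))

0≤2⁻¹ᐟ² : fromℕ 0 ≤ʳ 2⁻¹ᐟ²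
0≤2⁻¹ᐟ² ε 0<ε = 0 , λ i _ → ℚₚ.≤-trans
  (frac-≤ {0} {root₂ (suc i)} {0} {i} ℕ.z≤n)
  (subst (ℚ._≤ frac (root₂ (suc i)) i ℚ.+ ε) (ℚₚ.+-identityʳ (frac (root₂ (suc i)) i))
    (ℚₚ.+-monoʳ-≤ (frac (root₂ (suc i)) i) (ℚₚ.<⇒≤ 0<ε)))

2⁻¹ᐟ²-squared : 2⁻¹ᐟ² *ʳ 2⁻¹ᐟ² ≈ʳ fromℚ ½
2⁻¹ᐟ²-squared = below , above
  where
  sq : ℕ → ℚ
  sq i = seq 2⁻¹ᐟ² i ℚ.* seq 2⁻¹ᐟ² i

  below : 2⁻¹ᐟ² *ʳ 2⁻¹ᐟ² ≤ʳ fromℚ ½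
  below ε 0<ε = 0 , λ i _ → let p = root₂ (suc i) in begin
    sq i                                    ≡⟨ frac-* p p i i ⟩
    frac (p ℕ.* p) (i ℕ.+ i ℕ.* suc i)      ≤⟨ frac-≤ {p ℕ.* p} {1} {i ℕ.+ i ℕ.* suc i} {1} (lower i) ⟩
    ½                                       ≡⟨ sym (ℚₚ.+-identityʳ ½) ⟩
    ½ ℚ.+ 0ℚ                                ≤⟨ ℚₚ.+-monoʳ-≤ ½ (ℚₚ.<⇒≤ 0<ε) ⟩
    ½ ℚ.+ ε                                 ∎
    where
    open ℚₚ.≤-Reasoning
    lower : ∀ i → (root₂ (suc i) ℕ.* root₂ (suc i)) ℕ.* 2 ℕ.≤ 1 ℕ.* (suc i ℕ.* suc i)
    lower i = subst₂ ℕ._≤_ (ℕₚ.*-comm 2 (root₂ (suc i) ℕ.* root₂ (suc i)))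
      (sym (ℕₚ.*-identityˡ (suc i ℕ.* suc i))) (root₂-lower (suc i))

  -- With P = i + 1 and p = root₂ P: ½ ≤ ((p+1)/P)² ≤ p²/P² + 3/P.
  above : fromℚ ½ ≤ʳ 2⁻¹ᐟ² *ʳ 2⁻¹ᐟ²
  above ε 0<ε = let N , small = archimedean 3 ε 0<ε in N , λ i N≤i → bound i (small i N≤i)
    where
    bound : ∀ i → frac 3 i ℚ.≤ ε → ½ ℚ.≤ sq i ℚ.+ ε
    bound i small = begin
      ½                                      ≤⟨ frac-≤ {1} {p ℕ.* p ℕ.+ 3 ℕ.* P} {1} {k′} upper ⟩
      frac (p ℕ.* p ℕ.+ 3 ℕ.* P) k′          ≡⟨ sym (frac-+ (p ℕ.* p) (3 ℕ.* P) k′) ⟩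
      frac (p ℕ.* p) k′ ℚ.+ frac (3 ℕ.* P) k′ ≤⟨ ℚₚ.+-monoʳ-≤ (frac (p ℕ.* p) k′) (frac-≤ {3 ℕ.* P} {3} {k′} {i} (ℕₚ.≤-reflexive (ℕₚ.*-assoc 3 P P))) ⟩
      frac (p ℕ.* p) k′ ℚ.+ frac 3 i         ≤⟨ ℚₚ.+-mono-≤ (ℚₚ.≤-reflexive (sym (frac-* p p i i))) small ⟩
      sq i ℚ.+ ε                             ∎
      where
      p P k′ : ℕ
      p = root₂ (suc i)
      P = suc i
      k′ = i ℕ.+ i ℕ.* suc i
      p≤P : p ℕ.≤ P
      p≤P = ℕₚ.≮⇒≥ λ P<p → ℕₚ.<⇒≱ (ℕₚ.*-mono-< P<p P<p)
        (ℕₚ.≤-trans (ℕₚ.m≤n*m (p ℕ.* p) 2) (root₂-lower P))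
      upper : 1 ℕ.* (P ℕ.* P) ℕ.≤ (p ℕ.* p ℕ.+ 3 ℕ.* P) ℕ.* 2
      upper = ℕR.begin
        1 ℕ.* (P ℕ.* P)                          ℕR.≡⟨ ℕₚ.*-identityˡ (P ℕ.* P) ⟩
        P ℕ.* P                                  ℕR.≤⟨ ℕₚ.<⇒≤ (root₂-upper P) ⟩
        2 ℕ.* (suc p ℕ.* suc p)                  ℕR.≡⟨ solve 1 (λ x → con 2 :* ((con 1 :+ x) :* (con 1 :+ x)) := con 2 :* (x :* x) :+ (con 4 :* x :+ con 2)) refl p ⟩
        2 ℕ.* (p ℕ.* p) ℕ.+ (4 ℕ.* p ℕ.+ 2)      ℕR.≤⟨ ℕₚ.+-monoʳ-≤ (2 ℕ.* (p ℕ.* p)) (ℕₚ.+-mono-≤ (ℕₚ.*-monoʳ-≤ 4 p≤P) (ℕₚ.m≤m*n 2 P)) ⟩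
        2 ℕ.* (p ℕ.* p) ℕ.+ (4 ℕ.* P ℕ.+ 2 ℕ.* P) ℕR.≡⟨ solve 2 (λ x y → con 2 :* (x :* x) :+ (con 4 :* y :+ con 2 :* y) := (x :* x :+ con 3 :* y) :* con 2) refl p P ⟩
        (p ℕ.* p ℕ.+ 3 ℕ.* P) ℕ.* 2              ℕR.∎
        where
        module ℕR = ℕₚ.≤-Reasoning
        open +-*-Solver
      open ℚₚ.≤-Reasoning

-- A tournament on the vertex set Fin n; asymmetry also rules out loops.
record Tournament (n : ℕ) : Set₁ where
  field
    _⟶_   : Rel (Fin n) 0ℓ
    _⟶?_  : B.Decidable _⟶_
    asym  : ∀ {u v} → u ⟶ v → ¬ (v ⟶ u)
    total : ∀ {u v} → u ≢ v → (u ⟶ v) ⊎ (v ⟶ u)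

-- A bipartite digraph with parts V₁ = Fin m and V₂ = Fin k; v ⟶ u is the edge
-- from v ∈ V₁ to u ∈ V₂, and there are no other edges.
record BipartiteDigraph (m k : ℕ) : Set₁ where
  field
    _⟶_  : REL (Fin m) (Fin k) 0ℓ
    _⟶?_ : B.Decidable _⟶_

subset : {P : Pred (Fin n) ℓ} → Decidable P → Subset n
subset P? = tabulate (does ∘ P?)

image : (Fin m → Fin n) → Subset m → Subset n
image φ X = subset λ w → any? λ v → (v ∈? X) ×-dec (φ v ≟ᶠ w)

-- Common out-neighbourhood: a vacuous condition, hence everything, when S is empty.
N⁺ : Tournament n → Subset n → Subset n
N⁺ T S = subset λ w → all? λ s → (s ∈? S) →-dec (s ⟶? w)
  where open Tournament T

maximum : (Fin n → ℕ) → ℕ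
maximum g = foldr ℕ._⊔_ 0 (List.map g (allFin _))

module _ (D : BipartiteDigraph m k) where
  open BipartiteDigraph D

  inNbhd : Fin k → Subset m
  inNbhd u = subset λ v → v ⟶? u

  outNbhd : Fin m → Subset k
  outNbhd v = subset λ u → v ⟶? u

  -- Vertices of V₁ have in-degree 0 and vertices of V₂ have out-degree 0, so
  -- each maximum over V₁ ∪ V₂ is attained on the part considered (or is 0).
  Δ⁻ : ℕ
  Δ⁻ = maximum λ u → ∣ inNbhd u ∣

  Δ⁺ : ℕ
  Δ⁺ = maximum λ v → ∣ outNbhd v ∣

allSubsets : ∀ n → List (Subset n)
allSubsets zero    = [] List.∷ List.[]
allSubsets (suc n) = List.map (inside ∷_) (allSubsets n) ++ List.map (outside ∷_) (allSubsets n)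

subsetsOfSize : ℕ → Subset n → List (Subset n)
subsetsOfSize r A = filter (λ S → (S ⊆? A) ×-dec (∣ S ∣ ℕₚ.≟ r)) (allSubsets _)

-- P holds for all but at most a δ-fraction of the entries of L.
AllButFraction : {X : Set} {P : Pred X ℓ} → ℝ → Decidable P → List X → Set
AllButFraction δ P? L = fromℕ (length (filter (¬? ∘ P?) L)) ≤ʳ δ *ʳ fromℕ (length L)

{-# OPTIONS --safe #-}
module Submission where

-- A counting argument in the style of Rosenfeld replaces the local lemma.
-- Fix b candidates in each f v and let P(U) be the number of choices of a
-- candidate for every v ∈ V₁ that are injective on U and give every u with
-- N⁻(u) ⊆ U an image with at least c common out-neighbours in B.  Then
-- P(U ∪ {v}) ≥ (5/7) P(U), by induction on ∣U∣.  A choice counted by P(U) is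
-- lost either because v collides with some w ∈ U, which costs at most
-- m/b ≤ 1/32 of P(U), or because some out-neighbour u of v turns bad.  In the
-- latter case the choice restricts to one counted by P(U ∖ N⁻(u)), which by
-- induction is at most (7/5)^j P(U) with j = ∣N⁻(u)∣, while the values on N⁻(u)
-- form one of at most δ aʲ bad j-tuples out of bʲ.  As 2^(-1/2) ≤ 5/7, the bound
-- on δ makes this at most P(U)/(4Δ⁺) for each u, hence P(U)/4 in total, and
-- 1 − 1/32 − 1/4 ≥ 5/7.

open import Defs
open import Data.Bool.Base using (true; false; if_then_else_)
open import Data.Fin.Base using (Fin; zero; suc)
open import Data.Fin.Properties using (any?; all?; _≟_; suc-injective)
open import Data.Fin.Subset
open import Data.Fin.Subset.Properties
import Data.Integer.Base as ℤ
import Data.Integer.Properties as ℤₚ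
open import Data.List.Base using (List; []; _∷_; _++_; map; foldr; length; filter; allFin; cartesianProductWith)
open import Data.List.Membership.Propositional using () renaming (_∈_ to _∈ˡ_)
open import Data.List.Membership.Propositional.Properties using (∈-filter⁺; ∈-filter⁻; ∈-allFin)
open import Data.List.Properties using (map-++; map-cong; map-∘; map-tabulate; length-tabulate)
open import Data.List.Relation.Unary.All as All using ()
open import Data.List.Relation.Unary.AllPairs using (_∷_)
open import Data.List.Relation.Unary.Any using (here; there)
open import Data.List.Relation.Unary.Unique.Propositional using (Unique)
open import Data.List.Relation.Unary.Unique.Propositional.Properties using (filter⁺; allFin⁺)
open import Data.Nat.Base hiding (∣_-_∣)
open import Data.Nat.Induction using (<-rec)
open import Data.Nat.ListAction using (sum)
open import Data.Nat.ListAction.Properties using (sum-++)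
open import Data.Nat.Properties hiding (_≟_; suc-injective)
open import Data.Nat.Properties using () renaming (_≟_ to _≟ⁿ_)
open import Algebra.Properties.CommutativeSemigroup +-commutativeSemigroup using () renaming (interchange to +-interchange)
open import Algebra.Properties.CommutativeSemigroup *-commutativeSemigroup using () renaming (interchange to *-interchange; x∙yz≈y∙xz to *-left-comm)
open import Data.Nat.Solver using (module +-*-Solver)
open import Data.Product.Base using (∃-syntax; _×_; _,_; proj₁; proj₂)
open import Data.Rational.Base as ℚ using (ℚ; 0ℚ; 1ℚ; toℚᵘ)
import Data.Rational.Properties as ℚₚ
import Data.Rational.Solver as ℚSolver
open import Data.Rational.Unnormalised.Base as ℚᵘ using (mkℚᵘ)
import Data.Rational.Unnormalised.Properties as ℚᵘₚ
open import Data.Sum.Base using (inj₁; inj₂)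
open import Data.Vec.Base using (Vec; []; _∷_; here; there; lookup; _[_]≔_)
open import Data.Vec.Properties using (lookup∘tabulate; lookup∘update′; lookup⇒[]=; []=⇒lookup)
open import Function.Base using (_∘_; id; case_of_; it)
open import Function.Definitions using (Injective)
open import Level using (Level)
open import Relation.Binary.PropositionalEquality
open import Relation.Nullary.Decidable using (Dec; yes; no; does; ¬?; _×-dec_; _→-dec_; dec-true; dec-false; toWitness; decidable-stable)
open import Relation.Nullary.Negation using (¬_; contradiction)
open import Relation.Unary using (Pred; Decidable)

private
  variable
    p q : Level
    X Y Z : Set
    P : Set p
    Q : Set q
    b k m n : ℕ

-- Finite sums and indicators

-- Reading only `does` lets the indicator reduce along the constructors of `Fin` and `Subset`; the
-- inductions over coordinates rely on this definitionally.
⟦_⟧ : Dec P → ℕ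
⟦ P? ⟧ = if does P? then 1 else 0

⟦⟧-yes : (P? : Dec P) → P → ⟦ P? ⟧ ≡ 1
⟦⟧-yes P? p rewrite dec-true P? p = refl

⟦⟧-no : (P? : Dec P) → ¬ P → ⟦ P? ⟧ ≡ 0
⟦⟧-no P? ¬p rewrite dec-false P? ¬p = refl

⟦⟧≤1 : (P? : Dec P) → ⟦ P? ⟧ ≤ 1
⟦⟧≤1 (yes _) = ≤-refl
⟦⟧≤1 (no _)  = z≤n

⟦⟧>0 : (P? : Dec P) → ⟦ P? ⟧ > 0 → P
⟦⟧>0 (yes p) _ = p

⟦⟧-mono : (P? : Dec P) (Q? : Dec Q) → (P → Q) → ⟦ P? ⟧ ≤ ⟦ Q? ⟧
⟦⟧-mono (yes p) Q? f = ≤-reflexive (sym (⟦⟧-yes Q? (f p)))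
⟦⟧-mono (no _)  Q? f = z≤n

⟦⟧-cong : (P? : Dec P) (Q? : Dec Q) → (P → Q) → (Q → P) → ⟦ P? ⟧ ≡ ⟦ Q? ⟧
⟦⟧-cong P? Q? f g = ≤-antisym (⟦⟧-mono P? Q? f) (⟦⟧-mono Q? P? g)

⟦⟧-× : (P? : Dec P) (Q? : Dec Q) → ⟦ P? ×-dec Q? ⟧ ≡ ⟦ P? ⟧ * ⟦ Q? ⟧
⟦⟧-× (yes _) Q? = sym (+-identityʳ ⟦ Q? ⟧)
⟦⟧-× (no _)  Q? = refl

-- Makes a side condition such as `x ∉ S` available inside a sum over all of `Fin n`.
⟦⟧*-mono : (P? : Dec P) {k l : ℕ} → (P → k ≤ l) → ⟦ P? ⟧ * k ≤ ⟦ P? ⟧ * l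
⟦⟧*-mono (yes p) k≤l = *-monoʳ-≤ 1 (k≤l p)
⟦⟧*-mono (no _)  _   = z≤n

⟦⟧*-cong : (P? : Dec P) {k l : ℕ} → (P → k ≡ l) → ⟦ P? ⟧ * k ≡ ⟦ P? ⟧ * l
⟦⟧*-cong (yes p) k≡l = cong (1 *_) (k≡l p)
⟦⟧*-cong (no _)  _   = refl

∑ : List X → (X → ℕ) → ℕ
∑ xs f = sum (map f xs)

infix 5 ∑
syntax ∑ xs (λ x → e) = ∑[ x ← xs ] e

∑-cong : (xs : List X) {f g : X → ℕ} → (∀ x → f x ≡ g x) → ∑ xs f ≡ ∑ xs g
∑-cong xs f≗g = cong sum (map-cong f≗g xs)

∑-mono : (xs : List X) {f g : X → ℕ} → (∀ x → f x ≤ g x) → ∑ xs f ≤ ∑ xs g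
∑-mono []       _   = z≤n
∑-mono (x ∷ xs) f≤g = +-mono-≤ (f≤g x) (∑-mono xs f≤g)

∑-zero : (xs : List X) → ∑ xs (λ _ → 0) ≡ 0
∑-zero []       = refl
∑-zero (x ∷ xs) = ∑-zero xs

∑-const : (xs : List X) (k : ℕ) → ∑ xs (λ _ → k) ≡ length xs * k
∑-const []       k = refl
∑-const (x ∷ xs) k = cong (k +_) (∑-const xs k)

∑-+ : (xs : List X) (f g : X → ℕ) → ∑[ x ← xs ] (f x + g x) ≡ ∑ xs f + ∑ xs g
∑-+ []       f g = refl
∑-+ (x ∷ xs) f g = trans (cong (f x + g x +_) (∑-+ xs f g))
  (+-interchange (f x) (g x) (∑ xs f) (∑ xs g))

∑-*ˡ : (xs : List X) (k : ℕ) (f : X → ℕ) → ∑[ x ← xs ] (k * f x) ≡ k * ∑ xs f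
∑-*ˡ []       k f = sym (*-zeroʳ k)
∑-*ˡ (x ∷ xs) k f = trans (cong (k * f x +_) (∑-*ˡ xs k f)) (sym (*-distribˡ-+ k (f x) (∑ xs f)))

∑-*ʳ : (xs : List X) (k : ℕ) (f : X → ℕ) → ∑[ x ← xs ] (f x * k) ≡ ∑ xs f * k
∑-*ʳ xs k f = trans (∑-cong xs λ x → *-comm (f x) k) (trans (∑-*ˡ xs k f) (*-comm k (∑ xs f)))

∑-swap : (xs : List X) (ys : List Y) (f : X → Y → ℕ) →
  ∑[ x ← xs ] ∑[ y ← ys ] f x y ≡ ∑[ y ← ys ] ∑[ x ← xs ] f x y
∑-swap []       ys f = sym (∑-zero ys)
∑-swap (x ∷ xs) ys f = trans (cong (∑ ys (f x) +_) (∑-swap xs ys f))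
  (sym (∑-+ ys (f x) (λ y → ∑ xs λ x → f x y)))

∑-++ : (xs ys : List X) (f : X → ℕ) → ∑ (xs ++ ys) f ≡ ∑ xs f + ∑ ys f
∑-++ xs ys f = trans (cong sum (map-++ f xs ys)) (sum-++ (map f xs) (map f ys))

∑-map : (g : X → Y) (xs : List X) (f : Y → ℕ) → ∑ (map g xs) f ≡ ∑ xs (f ∘ g)
∑-map g xs f = cong sum (sym (map-∘ xs))

∑-cartesianProductWith : (g : X → Y → Z) (xs : List X) (ys : List Y) (f : Z → ℕ) →
  ∑ (cartesianProductWith g xs ys) f ≡ ∑[ x ← xs ] ∑[ y ← ys ] f (g x y)
∑-cartesianProductWith g []       ys f = refl
∑-cartesianProductWith g (x ∷ xs) ys f =
  trans (∑-++ (map (g x) ys) (cartesianProductWith g xs ys) f)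
    (cong₂ _+_ (∑-map (g x) ys f) (∑-cartesianProductWith g xs ys f))

∑-allFin-suc : (f : Fin (suc n) → ℕ) → ∑ (allFin (suc n)) f ≡ f zero + ∑ (allFin n) (f ∘ suc)
∑-allFin-suc {n} f = cong (f zero +_) (trans
  (cong (λ xs → ∑ xs f) (sym (map-tabulate {n = n} id suc)))
  (∑-map suc (allFin n) f))

length-allFin : ∀ n → length (allFin n) ≡ n
length-allFin n = length-tabulate {n = n} id

∑-≥-term : {xs : List X} (f : X → ℕ) {x : X} → x ∈ˡ xs → f x ≤ ∑ xs f
∑-≥-term {xs = x ∷ xs} f (here refl) = m≤m+n (f x) (∑ xs f)
∑-≥-term {xs = x ∷ xs} f (there x∈)  = ≤-trans (∑-≥-term f x∈) (m≤n+m (∑ xs f) (f x))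

∑>0⇒∃ : (xs : List X) (f : X → ℕ) → ∑ xs f > 0 → ∃[ x ] f x > 0
∑>0⇒∃ (x ∷ xs) f h with f x in eq
... | suc _ = x , subst (_> 0) (sym eq) z<s
... | zero  = ∑>0⇒∃ xs f h

length-filter-∑ : {P : Pred X p} (P? : Decidable P) (xs : List X) →
  length (filter P? xs) ≡ ∑[ x ← xs ] ⟦ P? x ⟧
length-filter-∑ P? []       = refl
length-filter-∑ P? (x ∷ xs) with does (P? x)
... | true  = cong suc (length-filter-∑ P? xs)
... | false = length-filter-∑ P? xs

∑-filter : {P : Pred X p} (P? : Decidable P) (xs : List X) (f : X → ℕ) →
  ∑ (filter P? xs) f ≡ ∑[ x ← xs ] ⟦ P? x ⟧ * f x
∑-filter P? []       f = refl
∑-filter P? (x ∷ xs) f with does (P? x)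
... | true  = cong₂ _+_ (sym (+-identityʳ (f x))) (∑-filter P? xs f)
... | false = ∑-filter P? xs f

∑-⟦≟⟧ : (y : Fin n) (f : Fin n → ℕ) → ∑[ x ← allFin n ] ⟦ y ≟ x ⟧ * f x ≡ f y
∑-⟦≟⟧ {suc n} zero f = trans (∑-allFin-suc λ x → ⟦ zero ≟ x ⟧ * f x)
  (trans (cong₂ _+_ (+-identityʳ (f zero)) (∑-zero (allFin n))) (+-identityʳ (f zero)))
∑-⟦≟⟧ {suc n} (suc y) f = trans (∑-allFin-suc λ x → ⟦ suc y ≟ x ⟧ * f x) (∑-⟦≟⟧ y (f ∘ suc))

∑-⟦unique⟧≤1 : {P : Pred (Fin n) p} (P? : Decidable P) → (∀ {x y} → P x → P y → x ≡ y) →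
  ∑[ x ← allFin n ] ⟦ P? x ⟧ ≤ 1
∑-⟦unique⟧≤1 {zero}  P? unique = z≤n
∑-⟦unique⟧≤1 {suc n} P? unique rewrite ∑-allFin-suc (λ x → ⟦ P? x ⟧) with P? zero
... | no _   = ∑-⟦unique⟧≤1 (P? ∘ suc) λ px py → suc-injective (unique px py)
... | yes p₀ = s≤s (≤-reflexive (trans
  (∑-cong (allFin n) λ x → ⟦⟧-no (P? (suc x)) λ px → contradiction (unique p₀ px) λ ())
  (∑-zero (allFin n))))

-- Sort the terms on the left by the value `y` of `g`: each `y` is hit at most once.
∑-injective : {g : Fin m → Fin n} → Injective _≡_ _≡_ g → (f : Fin n → ℕ) →
  ∑[ x ← allFin m ] f (g x) ≤ ∑[ y ← allFin n ] f y
∑-injective {m} {n} {g} inj f = begin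
  ∑[ x ← allFin m ] f (g x)                                  ≡⟨ ∑-cong (allFin m) (λ x → sym (∑-⟦≟⟧ (g x) f)) ⟩
  ∑[ x ← allFin m ] ∑[ y ← allFin n ] ⟦ g x ≟ y ⟧ * f y      ≡⟨ ∑-swap (allFin m) (allFin n) _ ⟩
  ∑[ y ← allFin n ] ∑[ x ← allFin m ] ⟦ g x ≟ y ⟧ * f y      ≡⟨ ∑-cong (allFin n) (λ y → ∑-*ʳ (allFin m) (f y) _) ⟩
  ∑[ y ← allFin n ] (∑[ x ← allFin m ] ⟦ g x ≟ y ⟧) * f y    ≤⟨ ∑-mono (allFin n) (λ y → *-monoˡ-≤ (f y) (∑-⟦unique⟧≤1 (λ x → g x ≟ y) λ p q → inj (trans p (sym q)))) ⟩
  ∑[ y ← allFin n ] 1 * f y                                  ≡⟨ ∑-cong (allFin n) (λ y → *-identityˡ (f y)) ⟩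
  ∑[ y ← allFin n ] f y                                      ∎
  where open ≤-Reasoning

∑-⟦∈⟧ : (S : Subset n) → ∑[ x ← allFin n ] ⟦ x ∈? S ⟧ ≡ ∣ S ∣
∑-⟦∈⟧ [] = refl
∑-⟦∈⟧ (inside  ∷ S) = trans (∑-allFin-suc λ x → ⟦ x ∈? (inside ∷ S) ⟧) (cong suc (∑-⟦∈⟧ S))
∑-⟦∈⟧ (outside ∷ S) = trans (∑-allFin-suc λ x → ⟦ x ∈? (outside ∷ S) ⟧) (∑-⟦∈⟧ S)

-- Words over a finite alphabet and independence from a coordinate

words : ∀ b m → List (Vec (Fin b) m)
words b zero    = [] ∷ []
words b (suc m) = cartesianProductWith _∷_ (allFin b) (words b m)

∑-words-suc : ∀ b m (F : Vec (Fin b) (suc m) → ℕ) →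
  ∑ (words b (suc m)) F ≡ ∑[ x ← allFin b ] ∑[ χ ← words b m ] F (x ∷ χ)
∑-words-suc b m = ∑-cartesianProductWith _∷_ (allFin b) (words b m)

∑-words-1 : ∀ b m → ∑[ χ ← words b m ] 1 ≡ b ^ m
∑-words-1 b zero    = refl
∑-words-1 b (suc m) = trans (∑-words-suc b m λ _ → 1) (trans (∑-const (allFin b) _)
  (cong₂ _*_ (length-allFin b) (∑-words-1 b m)))

IgnoresCoordinate : Fin m → (Vec (Fin b) m → ℕ) → Set
IgnoresCoordinate v F = ∀ χ x → F (χ [ v ]≔ x) ≡ F χ

∑-split-coordinate : (v : Fin m) (F : Vec (Fin b) m → ℕ) →
  ∑ (words b m) F ≡ ∑[ x ← allFin b ] ∑[ χ ← words b m ] ⟦ lookup χ v ≟ x ⟧ * F χ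
∑-split-coordinate {m} {b} v F = trans
  (∑-cong (words b m) λ χ → sym (∑-⟦≟⟧ (lookup χ v) (λ _ → F χ)))
  (∑-swap (words b m) (allFin b) _)

-- Since `F` does not see coordinate `v`, the `b` slices on which that coordinate is constant have
-- equal sums. This is independence from a uniform coordinate, with the division cleared.
∑-fix-coordinate : (v : Fin m) (F : Vec (Fin b) m → ℕ) → IgnoresCoordinate v F → ∀ x →
  b * (∑[ χ ← words b m ] ⟦ lookup χ v ≟ x ⟧ * F χ) ≡ ∑ (words b m) F
∑-fix-coordinate {suc m} {b} zero F ign x = begin
  b * (∑[ χ ← words b (suc m) ] ⟦ lookup χ zero ≟ x ⟧ * F χ)
    ≡⟨ cong (b *_) (∑-words-suc b m _) ⟩
  b * (∑[ y ← allFin b ] ∑[ χ ← words b m ] ⟦ y ≟ x ⟧ * F (y ∷ χ))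
    ≡⟨ cong (b *_) (∑-cong (allFin b) λ y → ∑-*ˡ (words b m) ⟦ y ≟ x ⟧ (λ χ → F (y ∷ χ))) ⟩
  b * (∑[ y ← allFin b ] ⟦ y ≟ x ⟧ * (∑[ χ ← words b m ] F (y ∷ χ)))
    ≡⟨ cong (b *_) (∑-cong (allFin b) λ y → cong (_* (∑[ χ ← words b m ] F (y ∷ χ))) (⟦⟧-cong (y ≟ x) (x ≟ y) sym sym)) ⟩
  b * (∑[ y ← allFin b ] ⟦ x ≟ y ⟧ * (∑[ χ ← words b m ] F (y ∷ χ)))
    ≡⟨ cong (b *_) (∑-⟦≟⟧ x _) ⟩
  b * (∑[ χ ← words b m ] F (x ∷ χ))
    ≡⟨ cong (_* (∑[ χ ← words b m ] F (x ∷ χ))) (sym (length-allFin b)) ⟩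
  length (allFin b) * (∑[ χ ← words b m ] F (x ∷ χ))
    ≡⟨ sym (∑-const (allFin b) _) ⟩
  ∑[ y ← allFin b ] ∑[ χ ← words b m ] F (x ∷ χ)
    ≡⟨ ∑-cong (allFin b) (λ y → ∑-cong (words b m) λ χ → ign (y ∷ χ) x) ⟩
  ∑[ y ← allFin b ] ∑[ χ ← words b m ] F (y ∷ χ)
    ≡⟨ sym (∑-words-suc b m F) ⟩
  ∑ (words b (suc m)) F ∎
  where open ≡-Reasoning
∑-fix-coordinate {suc m} {b} (suc v) F ign x = begin
  b * (∑[ χ ← words b (suc m) ] ⟦ lookup χ (suc v) ≟ x ⟧ * F χ)
    ≡⟨ cong (b *_) (∑-words-suc b m _) ⟩
  b * (∑[ y ← allFin b ] ∑[ χ ← words b m ] ⟦ lookup χ v ≟ x ⟧ * F (y ∷ χ))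
    ≡⟨ sym (∑-*ˡ (allFin b) b _) ⟩
  ∑[ y ← allFin b ] b * (∑[ χ ← words b m ] ⟦ lookup χ v ≟ x ⟧ * F (y ∷ χ))
    ≡⟨ ∑-cong (allFin b) (λ y → ∑-fix-coordinate v (λ χ → F (y ∷ χ)) (λ χ → ign (y ∷ χ)) x) ⟩
  ∑[ y ← allFin b ] ∑[ χ ← words b m ] F (y ∷ χ)
    ≡⟨ sym (∑-words-suc b m F) ⟩
  ∑ (words b (suc m)) F ∎
  where open ≡-Reasoning

-- Counting sequences of distinct elements

∣S∪⁅x⁆∣≡1+∣S∣ : {S : Subset n} {x : Fin n} → x ∉ S → ∣ S ∪ ⁅ x ⁆ ∣ ≡ suc ∣ S ∣
∣S∪⁅x⁆∣≡1+∣S∣ {S = inside  ∷ S} {zero}  x∉S = contradiction here x∉S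
∣S∪⁅x⁆∣≡1+∣S∣ {S = outside ∷ S} {zero}  x∉S = cong (suc ∘ ∣_∣) (∪-identityʳ S)
∣S∪⁅x⁆∣≡1+∣S∣ {S = inside  ∷ S} {suc x} x∉S = cong suc (∣S∪⁅x⁆∣≡1+∣S∣ (drop-not-there x∉S))
∣S∪⁅x⁆∣≡1+∣S∣ {S = outside ∷ S} {suc x} x∉S = ∣S∪⁅x⁆∣≡1+∣S∣ (drop-not-there x∉S)

∪⁅⁆-⊆ : {S S′ : Subset n} {x : Fin n} → S ⊆ S′ → x ∈ S′ → S ∪ ⁅ x ⁆ ⊆ S′
∪⁅⁆-⊆ {S = S} {S′} {x} S⊆S′ x∈S′ y∈ with x∈p∪q⁻ S ⁅ x ⁆ y∈
... | inj₁ y∈S = S⊆S′ y∈S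
... | inj₂ y∈x = subst (_∈ S′) (sym (x∈⁅y⁆⇒x≡y x y∈x)) x∈S′

x∈S∪⁅x⁆ : (S : Subset n) (x : Fin n) → x ∈ S ∪ ⁅ x ⁆
x∈S∪⁅x⁆ S x = q⊆p∪q S ⁅ x ⁆ (x∈⁅x⁆ x)

∑-allSubsets-suc : ∀ n (F : Subset (suc n) → ℕ) →
  ∑ (allSubsets (suc n)) F ≡ ∑ (allSubsets n) (F ∘ (inside ∷_)) + ∑ (allSubsets n) (F ∘ (outside ∷_))
∑-allSubsets-suc n F = trans (∑-++ (map (inside ∷_) (allSubsets n)) (map (outside ∷_) (allSubsets n)) F)
  (cong₂ _+_ (∑-map (inside ∷_) (allSubsets n) F) (∑-map (outside ∷_) (allSubsets n) F))

∑-allSubsets-∅ : ∀ n (F : Subset n → ℕ) → ∑[ S ← allSubsets n ] ⟦ ∣ S ∣ ≟ⁿ 0 ⟧ * F S ≡ F ⊥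
∑-allSubsets-∅ zero    F = trans (+-identityʳ _) (+-identityʳ (F []))
∑-allSubsets-∅ (suc n) F = trans (∑-allSubsets-suc n λ S → ⟦ ∣ S ∣ ≟ⁿ 0 ⟧ * F S)
  (cong₂ _+_ (∑-zero (allSubsets n)) (∑-allSubsets-∅ n (F ∘ (outside ∷_))))

-- Adding `x` is a bijection from the sets avoiding `x` to the sets containing it.
∑-insert : (x : Fin n) (F : Subset n → ℕ) →
  ∑[ S ← allSubsets n ] ⟦ ¬? (x ∈? S) ⟧ * F (S ∪ ⁅ x ⁆) ≡ ∑[ S ← allSubsets n ] ⟦ x ∈? S ⟧ * F S
∑-insert {suc n} zero F = begin
  ∑[ S ← allSubsets (suc n) ] ⟦ ¬? (zero ∈? S) ⟧ * F (S ∪ ⁅ zero ⁆)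
    ≡⟨ ∑-allSubsets-suc n (λ S → ⟦ ¬? (zero ∈? S) ⟧ * F (S ∪ ⁅ zero ⁆)) ⟩
  (∑[ S ← allSubsets n ] 0) + (∑[ S ← allSubsets n ] 1 * F (inside ∷ S ∪ ⊥))
    ≡⟨ +-comm (∑[ S ← allSubsets n ] 0) _ ⟩
  (∑[ S ← allSubsets n ] 1 * F (inside ∷ S ∪ ⊥)) + (∑[ S ← allSubsets n ] 0)
    ≡⟨ cong (_+ (∑[ S ← allSubsets n ] 0)) (∑-cong (allSubsets n) λ S → cong (λ S → 1 * F (inside ∷ S)) (∪-identityʳ S)) ⟩
  (∑[ S ← allSubsets n ] 1 * F (inside ∷ S)) + (∑[ S ← allSubsets n ] 0)
    ≡⟨ sym (∑-allSubsets-suc n (λ S → ⟦ zero ∈? S ⟧ * F S)) ⟩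
  ∑[ S ← allSubsets (suc n) ] ⟦ zero ∈? S ⟧ * F S ∎
  where open ≡-Reasoning
∑-insert {suc n} (suc x) F = begin
  ∑[ S ← allSubsets (suc n) ] ⟦ ¬? (suc x ∈? S) ⟧ * F (S ∪ ⁅ suc x ⁆)
    ≡⟨ ∑-allSubsets-suc n (λ S → ⟦ ¬? (suc x ∈? S) ⟧ * F (S ∪ ⁅ suc x ⁆)) ⟩
  (∑[ S ← allSubsets n ] ⟦ ¬? (x ∈? S) ⟧ * F (inside ∷ S ∪ ⁅ x ⁆)) + (∑[ S ← allSubsets n ] ⟦ ¬? (x ∈? S) ⟧ * F (outside ∷ S ∪ ⁅ x ⁆))
    ≡⟨ cong₂ _+_ (∑-insert x (F ∘ (inside ∷_))) (∑-insert x (F ∘ (outside ∷_))) ⟩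
  (∑[ S ← allSubsets n ] ⟦ x ∈? S ⟧ * F (inside ∷ S)) + (∑[ S ← allSubsets n ] ⟦ x ∈? S ⟧ * F (outside ∷ S))
    ≡⟨ sym (∑-allSubsets-suc n (λ S → ⟦ suc x ∈? S ⟧ * F S)) ⟩
  ∑[ S ← allSubsets (suc n) ] ⟦ suc x ∈? S ⟧ * F S ∎
  where open ≡-Reasoning

-- Double counting: each set arises once for every choice of its last inserted element.
∑-insert-any : (F : Subset n → ℕ) →
  ∑[ S ← allSubsets n ] ∑[ x ← allFin n ] ⟦ ¬? (x ∈? S) ⟧ * F (S ∪ ⁅ x ⁆) ≡ ∑[ S ← allSubsets n ] ∣ S ∣ * F S
∑-insert-any {n} F = begin
  ∑[ S ← allSubsets n ] ∑[ x ← allFin n ] ⟦ ¬? (x ∈? S) ⟧ * F (S ∪ ⁅ x ⁆)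
    ≡⟨ ∑-swap (allSubsets n) (allFin n) _ ⟩
  ∑[ x ← allFin n ] ∑[ S ← allSubsets n ] ⟦ ¬? (x ∈? S) ⟧ * F (S ∪ ⁅ x ⁆)
    ≡⟨ ∑-cong (allFin n) (λ x → ∑-insert x F) ⟩
  ∑[ x ← allFin n ] ∑[ S ← allSubsets n ] ⟦ x ∈? S ⟧ * F S
    ≡⟨ ∑-swap (allFin n) (allSubsets n) _ ⟩
  ∑[ S ← allSubsets n ] ∑[ x ← allFin n ] ⟦ x ∈? S ⟧ * F S
    ≡⟨ ∑-cong (allSubsets n) (λ S → trans (∑-*ʳ (allFin n) (F S) _) (cong (_* F S) (∑-⟦∈⟧ S))) ⟩
  ∑[ S ← allSubsets n ] ∣ S ∣ * F S ∎
  where open ≡-Reasoning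

-- ∑ F (S ∪ {x₁, …, xⱼ}) over the sequences of j distinct elements outside S.
extensions : (Subset n → ℕ) → ℕ → Subset n → ℕ
extensions     F zero    S = F S
extensions {n} F (suc j) S = ∑[ x ← allFin n ] ⟦ ¬? (x ∈? S) ⟧ * extensions F j (S ∪ ⁅ x ⁆)

-- The first new element is absorbed into the base set; each set of size `suc i` is reached in
-- `suc i` ways.
∑-extensions-suc : (F : Subset n → ℕ) (i j : ℕ) →
  ∑[ S ← allSubsets n ] ⟦ ∣ S ∣ ≟ⁿ i ⟧ * extensions F (suc j) S ≡
  suc i * (∑[ S ← allSubsets n ] ⟦ ∣ S ∣ ≟ⁿ suc i ⟧ * extensions F j S)
∑-extensions-suc {n} F i j = begin
  ∑[ S ← allSubsets n ] ⟦ ∣ S ∣ ≟ⁿ i ⟧ * extensions F (suc j) S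
    ≡⟨ ∑-cong (allSubsets n) (λ S → sym (∑-*ˡ (allFin n) ⟦ ∣ S ∣ ≟ⁿ i ⟧ _)) ⟩
  ∑[ S ← allSubsets n ] ∑[ x ← allFin n ] ⟦ ∣ S ∣ ≟ⁿ i ⟧ * (⟦ ¬? (x ∈? S) ⟧ * extensions F j (S ∪ ⁅ x ⁆))
    ≡⟨ ∑-cong (allSubsets n) (λ S → ∑-cong (allFin n) λ x → move S x) ⟩
  ∑[ S ← allSubsets n ] ∑[ x ← allFin n ] ⟦ ¬? (x ∈? S) ⟧ * G (S ∪ ⁅ x ⁆)
    ≡⟨ ∑-insert-any G ⟩
  ∑[ S ← allSubsets n ] ∣ S ∣ * G S
    ≡⟨ ∑-cong (allSubsets n) evaluate ⟩
  ∑[ S ← allSubsets n ] suc i * G S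
    ≡⟨ ∑-*ˡ (allSubsets n) (suc i) G ⟩
  suc i * ∑ (allSubsets n) G ∎
  where
  open ≡-Reasoning
  G : Subset n → ℕ
  G S = ⟦ ∣ S ∣ ≟ⁿ suc i ⟧ * extensions F j S
  move : ∀ S x → ⟦ ∣ S ∣ ≟ⁿ i ⟧ * (⟦ ¬? (x ∈? S) ⟧ * extensions F j (S ∪ ⁅ x ⁆)) ≡ ⟦ ¬? (x ∈? S) ⟧ * G (S ∪ ⁅ x ⁆)
  move S x = trans (*-left-comm ⟦ ∣ S ∣ ≟ⁿ i ⟧ ⟦ ¬? (x ∈? S) ⟧ _)
    (⟦⟧*-cong (¬? (x ∈? S)) λ x∉S → cong (_* extensions F j (S ∪ ⁅ x ⁆))
      (trans (⟦⟧-cong (∣ S ∣ ≟ⁿ i) (suc ∣ S ∣ ≟ⁿ suc i) (cong suc) (cong pred))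
        (cong (λ s → ⟦ s ≟ⁿ suc i ⟧) (sym (∣S∪⁅x⁆∣≡1+∣S∣ x∉S)))))
  evaluate : ∀ S → ∣ S ∣ * G S ≡ suc i * G S
  evaluate S = trans (*-left-comm ∣ S ∣ ⟦ ∣ S ∣ ≟ⁿ suc i ⟧ _) (trans
    (⟦⟧*-cong (∣ S ∣ ≟ⁿ suc i) λ eq → cong (_* extensions F j S) eq)
    (*-left-comm ⟦ ∣ S ∣ ≟ⁿ suc i ⟧ (suc i) _))

-- A set of size `i + j` arises from its `i`-subsets in `(i + j) ! / i !` ways in total; the factor
-- `i !` on the left avoids the quotient.
∑-extensions : (F : Subset n → ℕ) (i j : ℕ) →
  i ! * (∑[ S ← allSubsets n ] ⟦ ∣ S ∣ ≟ⁿ i ⟧ * extensions F j S) ≡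
  (i + j) ! * (∑[ S ← allSubsets n ] ⟦ ∣ S ∣ ≟ⁿ i + j ⟧ * F S)
∑-extensions F i zero rewrite +-identityʳ i = refl
∑-extensions {n} F i (suc j) rewrite +-suc i j = begin
  i ! * (∑[ S ← allSubsets n ] ⟦ ∣ S ∣ ≟ⁿ i ⟧ * extensions F (suc j) S)
    ≡⟨ cong (i ! *_) (∑-extensions-suc F i j) ⟩
  i ! * (suc i * R)
    ≡⟨ *-left-comm (i !) (suc i) R ⟩
  suc i * (i ! * R)
    ≡⟨ sym (*-assoc (suc i) (i !) R) ⟩
  suc i ! * R
    ≡⟨ ∑-extensions F (suc i) j ⟩
  suc (i + j) ! * (∑[ S ← allSubsets n ] ⟦ ∣ S ∣ ≟ⁿ suc (i + j) ⟧ * F S) ∎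
  where
  open ≡-Reasoning
  R : ℕ
  R = ∑[ S ← allSubsets n ] ⟦ ∣ S ∣ ≟ⁿ suc i ⟧ * extensions F j S

extensions-∅ : (F : Subset n → ℕ) (d : ℕ) →
  extensions F d ⊥ ≡ d ! * (∑[ S ← allSubsets n ] ⟦ ∣ S ∣ ≟ⁿ d ⟧ * F S)
extensions-∅ {n} F d = trans (sym (∑-allSubsets-∅ n (extensions F d)))
  (trans (sym (*-identityˡ _)) (∑-extensions F 0 d))

-- Tuples inside a set and the proportion of bad ones

module _ (A : Subset n) where

  within : Subset n → ℕ
  within S = ⟦ S ⊆? A ⟧

  ∣A∣≤∣S∣+∣A─S∣ : (S : Subset n) → ∣ A ∣ ≤ ∣ S ∣ + (∑[ x ← allFin n ] ⟦ ¬? (x ∈? S) ⟧ * ⟦ x ∈? A ⟧)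
  ∣A∣≤∣S∣+∣A─S∣ S = begin
    ∣ A ∣
      ≡⟨ sym (∑-⟦∈⟧ A) ⟩
    ∑[ x ← allFin n ] ⟦ x ∈? A ⟧
      ≤⟨ ∑-mono (allFin n) split ⟩
    ∑[ x ← allFin n ] (⟦ x ∈? S ⟧ + ⟦ ¬? (x ∈? S) ⟧ * ⟦ x ∈? A ⟧)
      ≡⟨ ∑-+ (allFin n) (λ x → ⟦ x ∈? S ⟧) _ ⟩
    (∑[ x ← allFin n ] ⟦ x ∈? S ⟧) + (∑[ x ← allFin n ] ⟦ ¬? (x ∈? S) ⟧ * ⟦ x ∈? A ⟧)
      ≡⟨ cong (_+ (∑[ x ← allFin n ] ⟦ ¬? (x ∈? S) ⟧ * ⟦ x ∈? A ⟧)) (∑-⟦∈⟧ S) ⟩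
    ∣ S ∣ + (∑[ x ← allFin n ] ⟦ ¬? (x ∈? S) ⟧ * ⟦ x ∈? A ⟧) ∎
    where
    open ≤-Reasoning
    split : ∀ x → ⟦ x ∈? A ⟧ ≤ ⟦ x ∈? S ⟧ + ⟦ ¬? (x ∈? S) ⟧ * ⟦ x ∈? A ⟧
    split x with x ∈? S
    ... | yes _ = ≤-trans (⟦⟧≤1 (x ∈? A)) (m≤m+n 1 _)
    ... | no _  = ≤-reflexive (sym (*-identityˡ ⟦ x ∈? A ⟧))

  ∣S∣+∣A─S∣≤∣A∣ : (S : Subset n) → S ⊆ A → ∣ S ∣ + (∑[ x ← allFin n ] ⟦ ¬? (x ∈? S) ⟧ * ⟦ x ∈? A ⟧) ≤ ∣ A ∣
  ∣S∣+∣A─S∣≤∣A∣ S S⊆A = begin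
    ∣ S ∣ + (∑[ x ← allFin n ] ⟦ ¬? (x ∈? S) ⟧ * ⟦ x ∈? A ⟧)
      ≡⟨ cong (_+ (∑[ x ← allFin n ] ⟦ ¬? (x ∈? S) ⟧ * ⟦ x ∈? A ⟧)) (sym (∑-⟦∈⟧ S)) ⟩
    (∑[ x ← allFin n ] ⟦ x ∈? S ⟧) + (∑[ x ← allFin n ] ⟦ ¬? (x ∈? S) ⟧ * ⟦ x ∈? A ⟧)
      ≡⟨ sym (∑-+ (allFin n) (λ x → ⟦ x ∈? S ⟧) _) ⟩
    ∑[ x ← allFin n ] (⟦ x ∈? S ⟧ + ⟦ ¬? (x ∈? S) ⟧ * ⟦ x ∈? A ⟧)
      ≤⟨ ∑-mono (allFin n) join ⟩
    ∑[ x ← allFin n ] ⟦ x ∈? A ⟧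
      ≡⟨ ∑-⟦∈⟧ A ⟩
    ∣ A ∣ ∎
    where
    open ≤-Reasoning
    join : ∀ x → ⟦ x ∈? S ⟧ + ⟦ ¬? (x ∈? S) ⟧ * ⟦ x ∈? A ⟧ ≤ ⟦ x ∈? A ⟧
    join x with x ∈? S
    ... | yes x∈S = ≤-reflexive (sym (⟦⟧-yes (x ∈? A) (S⊆A x∈S)))
    ... | no _    = ≤-reflexive (*-identityˡ ⟦ x ∈? A ⟧)

  -- The last of the `suc j` elements has to lie in `A` and avoid `∣ S ∣ + j` earlier elements of
  -- `A`. The induction peels off the first elements, so that the base case places the last one.
  extensions-shrink : (j : ℕ) (S : Subset n) →
    extensions within (suc j) S ≤ (∣ A ∣ ∸ (∣ S ∣ + j)) * extensions within j S
  extensions-shrink zero S with S ⊆? A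
  ... | yes S⊆A = begin
    ∑[ x ← allFin n ] ⟦ ¬? (x ∈? S) ⟧ * ⟦ S ∪ ⁅ x ⁆ ⊆? A ⟧
      ≤⟨ ∑-mono (allFin n) (λ x → *-monoʳ-≤ ⟦ ¬? (x ∈? S) ⟧ (⟦⟧-mono (S ∪ ⁅ x ⁆ ⊆? A) (x ∈? A) λ S∪x⊆A → S∪x⊆A (x∈S∪⁅x⁆ S x))) ⟩
    ∑[ x ← allFin n ] ⟦ ¬? (x ∈? S) ⟧ * ⟦ x ∈? A ⟧
      ≤⟨ m+n≤o⇒m≤o∸n _ (subst (_≤ ∣ A ∣) (+-comm ∣ S ∣ _) (∣S∣+∣A─S∣≤∣A∣ S S⊆A)) ⟩
    ∣ A ∣ ∸ ∣ S ∣
      ≡⟨ cong (∣ A ∣ ∸_) (sym (+-identityʳ ∣ S ∣)) ⟩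
    ∣ A ∣ ∸ (∣ S ∣ + 0)
      ≡⟨ sym (*-identityʳ _) ⟩
    (∣ A ∣ ∸ (∣ S ∣ + 0)) * 1 ∎
    where open ≤-Reasoning
  ... | no S⊈A = ≤-trans (≤-reflexive (trans
    (∑-cong (allFin n) λ x → trans (cong (⟦ ¬? (x ∈? S) ⟧ *_)
      (⟦⟧-no (S ∪ ⁅ x ⁆ ⊆? A) λ S∪x⊆A → S⊈A λ y∈S → S∪x⊆A (p⊆p∪q ⁅ x ⁆ y∈S))) (*-zeroʳ ⟦ ¬? (x ∈? S) ⟧))
    (∑-zero (allFin n)))) z≤n
  extensions-shrink (suc j) S = begin
    ∑[ x ← allFin n ] ⟦ ¬? (x ∈? S) ⟧ * extensions within (suc j) (S ∪ ⁅ x ⁆)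
      ≤⟨ ∑-mono (allFin n) (λ x → ⟦⟧*-mono (¬? (x ∈? S)) λ x∉S →
           ≤-trans (extensions-shrink j (S ∪ ⁅ x ⁆)) (≤-reflexive (cong (λ s → (∣ A ∣ ∸ s) * extensions within j (S ∪ ⁅ x ⁆)) (trans (cong (_+ j) (∣S∪⁅x⁆∣≡1+∣S∣ x∉S)) (sym (+-suc ∣ S ∣ j)))))) ⟩
    ∑[ x ← allFin n ] ⟦ ¬? (x ∈? S) ⟧ * ((∣ A ∣ ∸ (∣ S ∣ + suc j)) * extensions within j (S ∪ ⁅ x ⁆))
      ≡⟨ ∑-cong (allFin n) (λ x → *-left-comm ⟦ ¬? (x ∈? S) ⟧ (∣ A ∣ ∸ (∣ S ∣ + suc j)) _) ⟩
    ∑[ x ← allFin n ] (∣ A ∣ ∸ (∣ S ∣ + suc j)) * (⟦ ¬? (x ∈? S) ⟧ * extensions within j (S ∪ ⁅ x ⁆))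
      ≡⟨ ∑-*ˡ (allFin n) (∣ A ∣ ∸ (∣ S ∣ + suc j)) _ ⟩
    (∣ A ∣ ∸ (∣ S ∣ + suc j)) * extensions within (suc j) S ∎
    where open ≤-Reasoning

  extensions-within≤^ : (j : ℕ) → extensions within j ⊥ ≤ ∣ A ∣ ^ j
  extensions-within≤^ zero    = ⟦⟧≤1 (⊥ ⊆? A)
  extensions-within≤^ (suc j) = ≤-trans (extensions-shrink j ⊥)
    (*-mono-≤ (m∸n≤m ∣ A ∣ (∣ ⊥ {n} ∣ + j)) (extensions-within≤^ j))

  module _ {Bad : Subset n → Set} (Bad? : Decidable Bad) where

    badWithin : Subset n → ℕ
    badWithin S = ⟦ Bad? S ×-dec (S ⊆? A) ⟧

    module _ (Bad-mono : ∀ {S S′} → S ⊆ S′ → Bad S → Bad S′) where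

      -- The opposite estimate for bad sets: a bad set inside `A` stays bad and inside `A` when any
      -- remaining element of `A` is appended.
      extensions-grow : (j : ℕ) (S : Subset n) →
        (∣ A ∣ ∸ (∣ S ∣ + j)) * extensions badWithin j S ≤ extensions badWithin (suc j) S
      extensions-grow zero S with Bad? S | S ⊆? A
      ... | no _    | _       = ≤-trans (≤-reflexive (*-zeroʳ (∣ A ∣ ∸ (∣ S ∣ + 0)))) z≤n
      ... | yes _   | no _    = ≤-trans (≤-reflexive (*-zeroʳ (∣ A ∣ ∸ (∣ S ∣ + 0)))) z≤n
      ... | yes bad | yes S⊆A = begin
        (∣ A ∣ ∸ (∣ S ∣ + 0)) * 1
          ≡⟨ *-identityʳ _ ⟩
        ∣ A ∣ ∸ (∣ S ∣ + 0)
          ≡⟨ cong (∣ A ∣ ∸_) (+-identityʳ ∣ S ∣) ⟩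
        ∣ A ∣ ∸ ∣ S ∣
          ≤⟨ m≤n+o⇒m∸n≤o ∣ A ∣ ∣ S ∣ (∣A∣≤∣S∣+∣A─S∣ S) ⟩
        ∑[ x ← allFin n ] ⟦ ¬? (x ∈? S) ⟧ * ⟦ x ∈? A ⟧
          ≤⟨ ∑-mono (allFin n) (λ x → *-monoʳ-≤ ⟦ ¬? (x ∈? S) ⟧ (⟦⟧-mono (x ∈? A) (Bad? (S ∪ ⁅ x ⁆) ×-dec (S ∪ ⁅ x ⁆ ⊆? A))
               λ x∈A → Bad-mono (p⊆p∪q ⁅ x ⁆) bad , ∪⁅⁆-⊆ S⊆A x∈A)) ⟩
        ∑[ x ← allFin n ] ⟦ ¬? (x ∈? S) ⟧ * badWithin (S ∪ ⁅ x ⁆) ∎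
        where open ≤-Reasoning
      extensions-grow (suc j) S = begin
        (∣ A ∣ ∸ (∣ S ∣ + suc j)) * extensions badWithin (suc j) S
          ≡⟨ sym (∑-*ˡ (allFin n) (∣ A ∣ ∸ (∣ S ∣ + suc j)) _) ⟩
        ∑[ x ← allFin n ] (∣ A ∣ ∸ (∣ S ∣ + suc j)) * (⟦ ¬? (x ∈? S) ⟧ * extensions badWithin j (S ∪ ⁅ x ⁆))
          ≡⟨ ∑-cong (allFin n) (λ x → *-left-comm (∣ A ∣ ∸ (∣ S ∣ + suc j)) ⟦ ¬? (x ∈? S) ⟧ _) ⟩
        ∑[ x ← allFin n ] ⟦ ¬? (x ∈? S) ⟧ * ((∣ A ∣ ∸ (∣ S ∣ + suc j)) * extensions badWithin j (S ∪ ⁅ x ⁆))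
          ≤⟨ ∑-mono (allFin n) (λ x → ⟦⟧*-mono (¬? (x ∈? S)) λ x∉S →
               ≤-trans (≤-reflexive (cong (λ s → (∣ A ∣ ∸ s) * extensions badWithin j (S ∪ ⁅ x ⁆)) (trans (+-suc ∣ S ∣ j) (cong (_+ j) (sym (∣S∪⁅x⁆∣≡1+∣S∣ x∉S)))))) (extensions-grow j (S ∪ ⁅ x ⁆))) ⟩
        ∑[ x ← allFin n ] ⟦ ¬? (x ∈? S) ⟧ * extensions badWithin (suc j) (S ∪ ⁅ x ⁆) ∎
        where open ≤-Reasoning

      private
        bad all : ℕ → ℕ
        bad j = extensions badWithin j ⊥
        all j = extensions within j ⊥

        remaining : ℕ → ℕ
        remaining j = ∣ A ∣ ∸ (∣ ⊥ {n} ∣ + j)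

      -- Supersets of bad sets are bad, so the bad fraction of d-tuples bounds that of shorter ones.
      bad-fraction-descends : (K L d : ℕ) → d ≤ ∣ A ∣ → bad d * K ≤ all d * L →
        ∀ {j} → j ≤′ d → bad j * K ≤ all j * L
      bad-fraction-descends K L d d≤a h ≤′-refl = h
      bad-fraction-descends K L (suc d) d<a h (≤′-step j≤d) =
        bad-fraction-descends K L d (<⇒≤ d<a) (*-cancelˡ-≤ (remaining d) {{>-nonZero remaining>0}} (begin
          remaining d * (bad d * K)    ≡⟨ sym (*-assoc (remaining d) (bad d) K) ⟩
          remaining d * bad d * K      ≤⟨ *-monoˡ-≤ K (extensions-grow d ⊥) ⟩
          bad (suc d) * K              ≤⟨ h ⟩
          all (suc d) * L              ≤⟨ *-monoˡ-≤ L (extensions-shrink d ⊥) ⟩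
          remaining d * all d * L      ≡⟨ *-assoc (remaining d) (all d) L ⟩
          remaining d * (all d * L)    ∎)) j≤d
        where
        open ≤-Reasoning
        remaining>0 : remaining d > 0
        remaining>0 = m<n⇒0<n∸m (subst (λ z → z + d < ∣ A ∣) (sym (∣⊥∣≡0 n)) d<a)

      -- The hypothesis says that the bad fraction of `d`-sets is at most `L / K`. Multiplying by
      -- `d !` turns sets into ordered tuples, the fraction descends to length `j`, and there are at
      -- most `∣ A ∣ ^ j` tuples of that length.
      bad-extensions-bound : (K L d : ℕ) → d ≤ ∣ A ∣ →
        length (filter Bad? (subsetsOfSize d A)) * K ≤ length (subsetsOfSize d A) * L →
        ∀ {j} → j ≤ d → bad j * K ≤ ∣ A ∣ ^ j * L
      bad-extensions-bound K L d d≤a h {j} j≤d = ≤-trans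
        (bad-fraction-descends K L d d≤a scaled (≤⇒≤′ j≤d)) (*-monoˡ-≤ L (extensions-within≤^ j))
        where
        open ≤-Reasoning
        all-count : all d ≡ d ! * length (subsetsOfSize d A)
        all-count = trans (extensions-∅ within d) (cong (d ! *_) (sym (trans
          (length-filter-∑ (λ S → (S ⊆? A) ×-dec (∣ S ∣ ≟ⁿ d)) (allSubsets n))
          (∑-cong (allSubsets n) λ S → trans (⟦⟧-× (S ⊆? A) (∣ S ∣ ≟ⁿ d)) (*-comm ⟦ S ⊆? A ⟧ ⟦ ∣ S ∣ ≟ⁿ d ⟧)))))
        bad-count : bad d ≡ d ! * length (filter Bad? (subsetsOfSize d A))
        bad-count = trans (extensions-∅ badWithin d) (cong (d ! *_) (sym (trans
          (length-filter-∑ Bad? (subsetsOfSize d A)) (trans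
          (∑-filter (λ S → (S ⊆? A) ×-dec (∣ S ∣ ≟ⁿ d)) (allSubsets n) (λ S → ⟦ Bad? S ⟧))
          (∑-cong (allSubsets n) λ S → regroup S)))))
          where
          regroup : ∀ S → ⟦ (S ⊆? A) ×-dec (∣ S ∣ ≟ⁿ d) ⟧ * ⟦ Bad? S ⟧ ≡ ⟦ ∣ S ∣ ≟ⁿ d ⟧ * badWithin S
          regroup S rewrite ⟦⟧-× (S ⊆? A) (∣ S ∣ ≟ⁿ d) | ⟦⟧-× (Bad? S) (S ⊆? A) =
            solve 3 (λ x y z → x :* y :* z := y :* (z :* x)) refl ⟦ S ⊆? A ⟧ ⟦ ∣ S ∣ ≟ⁿ d ⟧ ⟦ Bad? S ⟧
            where open +-*-Solver using (solve; _:*_; _:=_)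
        scaled : bad d * K ≤ all d * L
        scaled = begin
          bad d * K                                                   ≡⟨ cong (_* K) bad-count ⟩
          d ! * length (filter Bad? (subsetsOfSize d A)) * K          ≡⟨ *-assoc (d !) _ K ⟩
          d ! * (length (filter Bad? (subsetsOfSize d A)) * K)        ≤⟨ *-monoʳ-≤ (d !) h ⟩
          d ! * (length (subsetsOfSize d A) * L)                      ≡⟨ sym (*-assoc (d !) _ L) ⟩
          d ! * length (subsetsOfSize d A) * L                        ≡⟨ cong (_* L) (sym all-count) ⟩
          all d * L                                                   ∎

-- From the real parameter to natural numbers

ι : ℕ → ℚ
ι p = ℤ.+ p ℚ./ 1

private
  toℚᵘ-/ : ∀ p i → toℚᵘ (ℤ.+ p ℚ./ suc i) ℚᵘ.≃ mkℚᵘ (ℤ.+ p) i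
  toℚᵘ-/ p i = ℚₚ.toℚᵘ-fromℚᵘ (mkℚᵘ (ℤ.+ p) i)

/-*-ι : ∀ r i → (ℤ.+ r ℚ./ suc i) ℚ.* ι (suc i) ≡ ι r
/-*-ι r i = ℚₚ.toℚᵘ-injective (begin
  toℚᵘ ((ℤ.+ r ℚ./ suc i) ℚ.* ι (suc i))            ≈⟨ ℚₚ.toℚᵘ-homo-* (ℤ.+ r ℚ./ suc i) (ι (suc i)) ⟩
  toℚᵘ (ℤ.+ r ℚ./ suc i) ℚᵘ.* toℚᵘ (ι (suc i))      ≈⟨ ℚᵘₚ.*-cong (toℚᵘ-/ r i) (toℚᵘ-/ (suc i) 0) ⟩
  mkℚᵘ (ℤ.+ r) i ℚᵘ.* mkℚᵘ (ℤ.+ suc i) 0              ≈⟨ ℚᵘ.*≡* (trans (ℤₚ.*-identityʳ _) (cong (λ s → ℤ.+ r ℤ.* ℤ.+ s) (sym (*-identityʳ (suc i))))) ⟩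
  mkℚᵘ (ℤ.+ r) 0                                    ≈⟨ ℚᵘₚ.≃-sym (toℚᵘ-/ r 0) ⟩
  toℚᵘ (ι r)                                      ∎)
  where open ℚᵘₚ.≃-Reasoning

ι-+ : ∀ p q → ι (p + q) ≡ ι p ℚ.+ ι q
ι-+ p q = ℚₚ.toℚᵘ-injective (begin
  toℚᵘ (ι (p + q))                  ≈⟨ toℚᵘ-/ (p + q) 0 ⟩
  mkℚᵘ (ℤ.+ (p + q)) 0                ≈⟨ ℚᵘ.*≡* (cong (ℤ._* ℤ.+ 1) (sym (cong₂ ℤ._+_ (ℤₚ.*-identityʳ (ℤ.+ p)) (ℤₚ.*-identityʳ (ℤ.+ q))))) ⟩
  mkℚᵘ (ℤ.+ p) 0 ℚᵘ.+ mkℚᵘ (ℤ.+ q) 0    ≈⟨ ℚᵘₚ.≃-sym (ℚᵘₚ.+-cong (toℚᵘ-/ p 0) (toℚᵘ-/ q 0)) ⟩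
  toℚᵘ (ι p) ℚᵘ.+ toℚᵘ (ι q)        ≈⟨ ℚᵘₚ.≃-sym (ℚₚ.toℚᵘ-homo-+ (ι p) (ι q)) ⟩
  toℚᵘ (ι p ℚ.+ ι q)                ∎)
  where open ℚᵘₚ.≃-Reasoning

ι-* : ∀ p q → ι (p * q) ≡ ι p ℚ.* ι q
ι-* p q = ℚₚ.toℚᵘ-injective (begin
  toℚᵘ (ι (p * q))                  ≈⟨ toℚᵘ-/ (p * q) 0 ⟩
  mkℚᵘ (ℤ.+ (p * q)) 0                ≈⟨ ℚᵘ.*≡* (cong (ℤ._* ℤ.+ 1) (ℤₚ.pos-* p q)) ⟩
  mkℚᵘ (ℤ.+ p) 0 ℚᵘ.* mkℚᵘ (ℤ.+ q) 0    ≈⟨ ℚᵘₚ.≃-sym (ℚᵘₚ.*-cong (toℚᵘ-/ p 0) (toℚᵘ-/ q 0)) ⟩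
  toℚᵘ (ι p) ℚᵘ.* toℚᵘ (ι q)        ≈⟨ ℚᵘₚ.≃-sym (ℚₚ.toℚᵘ-homo-* (ι p) (ι q)) ⟩
  toℚᵘ (ι p ℚ.* ι q)                ∎)
  where open ℚᵘₚ.≃-Reasoning

ι-mono-≤ : ∀ {p q} → p ≤ q → ι p ℚ.≤ ι q
ι-mono-≤ {p} {q} p≤q = ℚₚ.toℚᵘ-cancel-≤
  (ℚᵘₚ.≤-respˡ-≃ (ℚᵘₚ.≃-sym (toℚᵘ-/ p 0)) (ℚᵘₚ.≤-respʳ-≃ (ℚᵘₚ.≃-sym (toℚᵘ-/ q 0))
    (ℚᵘ.*≤* (ℤₚ.*-monoʳ-≤-nonNeg (ℤ.+ 1) (ℤ.+≤+ p≤q)))))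

0≤ι : ∀ p → 0ℚ ℚ.≤ ι p
0≤ι p = ι-mono-≤ {0} {p} z≤n

0</ : ∀ i → 0ℚ ℚ.< ℤ.+ 1 ℚ./ suc i
0</ i = ℚₚ.positive⁻¹ (ℤ.+ 1 ℚ./ suc i) {{ℚₚ.normalize-pos 1 (suc i)}}

*-monoˡ : ∀ {p q r} → 0ℚ ℚ.≤ r → p ℚ.≤ q → p ℚ.* r ℚ.≤ q ℚ.* r
*-monoˡ {r = r} 0≤r = ℚₚ.*-monoʳ-≤-nonNeg r {{ℚ.nonNegative 0≤r}}

*-mono : ∀ {p q r s} → 0ℚ ℚ.≤ r → 0ℚ ℚ.≤ q → p ℚ.≤ q → r ℚ.≤ s → p ℚ.* r ℚ.≤ q ℚ.* s
*-mono {q = q} 0≤r 0≤q p≤q r≤s = ℚₚ.≤-trans (*-monoˡ 0≤r p≤q)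
  (ℚₚ.*-monoˡ-≤-nonNeg q {{ℚ.nonNegative 0≤q}} r≤s)

0≤* : ∀ {p q} → 0ℚ ℚ.≤ p → 0ℚ ℚ.≤ q → 0ℚ ℚ.≤ p ℚ.* q
0≤* {p} {q} 0≤p 0≤q = subst (ℚ._≤ p ℚ.* q) (ℚₚ.*-zeroˡ q) (*-monoˡ 0≤q 0≤p)

-- If p·M exceeded C·N, it would do so by at least 1; but the two real
-- inequalities, read with precision ε = 1/(C·M + M + 1), leave a slack below 1.
fraction-bound : ∀ {δ y} p C M N → (∀ i → seq y i ℚ.* ι M ℚ.≤ ι N) →
  δ ≤ʳ y → fromℕ p ≤ʳ δ *ʳ fromℕ C → p * M ≤ C * N
fraction-bound {δ} {y} p C M N yM≤N δ≤y p≤δC = ≮⇒≥ λ CN<pM →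
  let i₁ , δ≤y+ε  = δ≤y ε (0</ (C * M + M))
      i₂ , p≤δC+ε = p≤δC ε (0</ (C * M + M))
      i = i₁ ⊔ i₂
      δᵢ = seq δ i
      yᵢ = seq y i
  in ℚₚ.<-irrefl refl (begin-strict
    ι p ℚ.* ι M
      ≤⟨ *-monoˡ (0≤ι M) (p≤δC+ε i (m≤n⊔m i₁ i₂)) ⟩
    (δᵢ ℚ.* ι C ℚ.+ ε) ℚ.* ι M
      ≤⟨ *-monoˡ (0≤ι M) (ℚₚ.+-monoˡ-≤ ε (*-monoˡ (0≤ι C) (δ≤y+ε i (m≤m⊔n i₁ i₂)))) ⟩
    ((yᵢ ℚ.+ ε) ℚ.* ι C ℚ.+ ε) ℚ.* ι M
      ≡⟨ expand yᵢ ε (ι C) (ι M) ⟩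
    ι C ℚ.* (yᵢ ℚ.* ι M) ℚ.+ ε ℚ.* (ι C ℚ.* ι M ℚ.+ ι M)
      ≤⟨ ℚₚ.+-monoˡ-≤ _ (ℚₚ.*-monoˡ-≤-nonNeg (ι C) {{ℚ.nonNegative (0≤ι C)}} (yM≤N i)) ⟩
    ι C ℚ.* ι N ℚ.+ ε ℚ.* (ι C ℚ.* ι M ℚ.+ ι M)
      ≡⟨ cong₂ (λ s t → s ℚ.+ ε ℚ.* t) (sym (ι-* C N)) (trans (cong (ℚ._+ ι M) (sym (ι-* C M))) (sym (ι-+ (C * M) M))) ⟩
    ι (C * N) ℚ.+ ε ℚ.* ι (C * M + M)
      <⟨ ℚₚ.+-monoʳ-< (ι (C * N)) small ⟩
    ι (C * N) ℚ.+ 1ℚ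
      ≡⟨ trans (sym (ι-+ (C * N) 1)) (cong ι (+-comm (C * N) 1)) ⟩
    ι (suc (C * N))
      ≤⟨ ι-mono-≤ CN<pM ⟩
    ι (p * M)
      ≡⟨ ι-* p M ⟩
    ι p ℚ.* ι M ∎)
  where
  open ℚₚ.≤-Reasoning
  ε : ℚ
  ε = ℤ.+ 1 ℚ./ suc (C * M + M)
  expand : ∀ y ε C M → ((y ℚ.+ ε) ℚ.* C ℚ.+ ε) ℚ.* M ≡ C ℚ.* (y ℚ.* M) ℚ.+ ε ℚ.* (C ℚ.* M ℚ.+ M)
  expand = solve 4 (λ y ε C M → ((y :+ ε) :* C :+ ε) :* M := C :* (y :* M) :+ ε :* (C :* M :+ M)) refl
    where open ℚSolver.+-*-Solver
  small : ε ℚ.* ι (C * M + M) ℚ.< 1ℚ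
  small = begin-strict
    ε ℚ.* ι (C * M + M)               ≡⟨ sym (ℚₚ.+-identityˡ _) ⟩
    0ℚ ℚ.+ ε ℚ.* ι (C * M + M)        <⟨ ℚₚ.+-monoˡ-< (ε ℚ.* ι (C * M + M)) (0</ (C * M + M)) ⟩
    ε ℚ.+ ε ℚ.* ι (C * M + M)         ≡⟨ cong (ℚ._+ ε ℚ.* ι (C * M + M)) (sym (ℚₚ.*-identityʳ ε)) ⟩
    ε ℚ.* 1ℚ ℚ.+ ε ℚ.* ι (C * M + M)  ≡⟨ sym (ℚₚ.*-distribˡ-+ ε 1ℚ (ι (C * M + M))) ⟩
    ε ℚ.* (1ℚ ℚ.+ ι (C * M + M))      ≡⟨ cong (ε ℚ.*_) (sym (ι-+ 1 (C * M + M))) ⟩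
    ε ℚ.* ι (suc (C * M + M))         ≡⟨ /-*-ι 1 (C * M + M) ⟩
    1ℚ                                ∎

0≤/ : ∀ r i → 0ℚ ℚ.≤ ℤ.+ r ℚ./ suc i
0≤/ r i = ℚₚ.nonNegative⁻¹ (ℤ.+ r ℚ./ suc i) {{ℚₚ.normalize-nonNeg r (suc i)}}

-- As `(5/7)² = 25/49` exceeds 1/2, the rational 5/7 bounds 2^(-1/2) from above; after squaring and
-- clearing denominators this is 49 ≤ 50.
7root₂≤5 : ∀ i → 7 * root₂ i ≤ 5 * i
7root₂≤5 i = ≮⇒≥ λ 5i<7r → <-irrefl refl (begin-strict
  2 * ((5 * i) * (5 * i))    <⟨ *-monoʳ-< 2 (*-mono-< 5i<7r 5i<7r) ⟩
  2 * ((7 * r) * (7 * r))    ≡⟨ solve 1 (λ r → con 2 :* ((con 7 :* r) :* (con 7 :* r)) := con 49 :* (con 2 :* (r :* r))) refl r ⟩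
  49 * (2 * (r * r))         ≤⟨ *-monoʳ-≤ 49 (root₂-lower i) ⟩
  49 * (i * i)               ≤⟨ *-monoˡ-≤ (i * i) (n≤1+n 49) ⟩
  50 * (i * i)               ≡⟨ solve 1 (λ i → con 50 :* (i :* i) := con 2 :* ((con 5 :* i) :* (con 5 :* i))) refl i ⟩
  2 * ((5 * i) * (5 * i))    ∎)
  where
  open ≤-Reasoning
  open +-*-Solver
  r : ℕ
  r = root₂ i

seq-2⁻¹ᐟ²-≤ : ∀ i → seq 2⁻¹ᐟ² i ℚ.* ι 7 ℚ.≤ ι 5
seq-2⁻¹ᐟ²-≤ i = ℚₚ.*-cancelʳ-≤-pos (ι (suc i)) {{ℚₚ.normalize-pos (suc i) 1}} (begin
  s ℚ.* ι 7 ℚ.* ι (suc i)      ≡⟨ solve 3 (λ s t u → s :* t :* u := t :* (s :* u)) refl s (ι 7) (ι (suc i)) ⟩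
  ι 7 ℚ.* (s ℚ.* ι (suc i))    ≡⟨ cong (ι 7 ℚ.*_) (/-*-ι (root₂ (suc i)) i) ⟩
  ι 7 ℚ.* ι (root₂ (suc i))    ≡⟨ sym (ι-* 7 (root₂ (suc i))) ⟩
  ι (7 * root₂ (suc i))        ≤⟨ ι-mono-≤ (7root₂≤5 (suc i)) ⟩
  ι (5 * suc i)                ≡⟨ ι-* 5 (suc i) ⟩
  ι 5 ℚ.* ι (suc i)            ∎)
  where
  open ℚₚ.≤-Reasoning
  open ℚSolver.+-*-Solver
  s : ℚ
  s = seq 2⁻¹ᐟ² i

-- A bound `0 ≤ x ≤ N / M` on every term of the representing sequence. Nonnegativity is carried
-- along so that such bounds can be multiplied.
_≼_/_ : ℝ → ℕ → ℕ → Set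
x ≼ N / M = ∀ i → 0ℚ ℚ.≤ seq x i × seq x i ℚ.* ι M ℚ.≤ ι N

≼-* : ∀ {x y N M N′ M′} → x ≼ N / M → y ≼ N′ / M′ → (x *ʳ y) ≼ (N * N′) / (M * M′)
≼-* {x} {y} {N} {M} {N′} {M′} x≼ y≼ i = 0≤* (proj₁ (x≼ i)) (proj₁ (y≼ i)) , (begin
  xᵢ ℚ.* yᵢ ℚ.* ι (M * M′)              ≡⟨ cong (xᵢ ℚ.* yᵢ ℚ.*_) (ι-* M M′) ⟩
  xᵢ ℚ.* yᵢ ℚ.* (ι M ℚ.* ι M′)          ≡⟨ solve 4 (λ x y m m′ → x :* y :* (m :* m′) := x :* m :* (y :* m′)) refl xᵢ yᵢ (ι M) (ι M′) ⟩
  xᵢ ℚ.* ι M ℚ.* (yᵢ ℚ.* ι M′)          ≤⟨ *-mono (0≤* (proj₁ (y≼ i)) (0≤ι M′)) (0≤ι N) (proj₂ (x≼ i)) (proj₂ (y≼ i)) ⟩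
  ι N ℚ.* ι N′                          ≡⟨ sym (ι-* N N′) ⟩
  ι (N * N′)                            ∎)
  where
  open ℚₚ.≤-Reasoning
  open ℚSolver.+-*-Solver
  xᵢ yᵢ : ℚ
  xᵢ = seq x i
  yᵢ = seq y i

≼-^ : ∀ {x N M} → x ≼ N / M → ∀ d → (x ^ʳ d) ≼ (N ^ d) / (M ^ d)
≼-^ x≼ zero    i = 0≤ι 1 , ℚₚ.≤-refl
≼-^ {x} {N} {M} x≼ (suc d) = ≼-* {x} {x ^ʳ d} {N} {M} {N ^ d} {M ^ d} x≼ (≼-^ {x} {N} {M} x≼ d)

≼-1/ : ∀ k → fromℚ (ℤ.+ 1 ℚ./ suc k) ≼ 1 / suc k
≼-1/ k _ = 0≤/ 1 k , ℚₚ.≤-reflexive (/-*-ι 1 k)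

≼-fromℕ : ∀ p → fromℕ p ≼ p / 1
≼-fromℕ p _ = 0≤ι p , ℚₚ.≤-reflexive (ℚₚ.*-identityʳ (ι p))

-- Replacing 2^(-1/2) by its upper bound 5/7 makes the bound on `δ` rational, so both real
-- inequalities combine into one between natural numbers. The `NonZero` arguments exclude the junk
-- value of `_/ʳ_`.
few-bad : ∀ {δ} p C b a e d .{{_ : NonZero a}} .{{_ : NonZero e}} →
  δ ≤ʳ (2⁻¹ᐟ² *ʳ (fromℕ b /ʳ a)) ^ʳ d /ʳ e → fromℕ p ≤ʳ δ *ʳ fromℕ C →
  p * (e * (7 * a) ^ d) ≤ C * (5 * b) ^ d
few-bad {δ} p C b (suc a) (suc e) d δ≤ p≤ = subst₂ (λ M N → p * M ≤ C * N)
  (trans (*-comm _ (suc e)) (cong (λ a → suc e * (7 * a) ^ d) (*-identityˡ (suc a))))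
  (trans (*-identityʳ _) (cong (λ b → (5 * b) ^ d) (*-identityʳ b)))
  (fraction-bound {δ} {y ^ʳ d /ʳ suc e} p C M N (λ i → proj₂ (bound i)) δ≤ p≤)
  where
  y : ℝ
  y = 2⁻¹ᐟ² *ʳ (fromℕ b /ʳ suc a)
  -- These unsimplified products are the form that `≼-*` yields; the factors 1 are removed by the
  -- `subst₂`.
  M N : ℕ
  M = (7 * (1 * suc a)) ^ d * suc e
  N = (5 * (b * 1)) ^ d * 1
  bound : (y ^ʳ d /ʳ suc e) ≼ N / M
  bound = ≼-* {y ^ʳ d} {fromℚ (ℤ.+ 1 ℚ./ suc e)} {(5 * (b * 1)) ^ d} {(7 * (1 * suc a)) ^ d} {1} {suc e}
    (≼-^ {y} {5 * (b * 1)} {7 * (1 * suc a)}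
      (≼-* {2⁻¹ᐟ²} {fromℕ b /ʳ suc a} {5} {7} {b * 1} {1 * suc a}
        (λ i → 0≤/ (root₂ (suc i)) i , seq-2⁻¹ᐟ²-≤ i)
        (≼-* {fromℕ b} {fromℚ (ℤ.+ 1 ℚ./ suc a)} {b} {1} {1} {suc a} (≼-fromℕ b) (≼-1/ a))) d)
    (≼-1/ e)

-- Subsets, images and words of choices

∈-subset⁺ : {P : Pred (Fin n) p} (P? : Decidable P) {x : Fin n} → P x → x ∈ subset P?
∈-subset⁺ P? {x} px = lookup⇒[]= x (subset P?) (trans (lookup∘tabulate (does ∘ P?) x) (dec-true (P? x) px))

∈-subset⁻ : {P : Pred (Fin n) p} (P? : Decidable P) {x : Fin n} → x ∈ subset P? → P x
∈-subset⁻ P? {x} x∈ with P? x | trans (sym (lookup∘tabulate (does ∘ P?) x)) ([]=⇒lookup x∈)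
... | yes px | _  = px
... | no _   | ()

∈-image⁺ : (φ : Fin m → Fin n) {U : Subset m} {v : Fin m} → v ∈ U → φ v ∈ image φ U
∈-image⁺ φ {U} {v} v∈U = ∈-subset⁺ (λ w → any? λ v → (v ∈? U) ×-dec (φ v ≟ w)) (v , v∈U , refl)

∈-image⁻ : (φ : Fin m → Fin n) {U : Subset m} {w : Fin n} → w ∈ image φ U → ∃[ v ] v ∈ U × φ v ≡ w
∈-image⁻ φ {U} = ∈-subset⁻ λ w → any? λ v → (v ∈? U) ×-dec (φ v ≟ w)

image-⊆ : (φ : Fin m → Fin n) {U : Subset m} {S : Subset n} → (∀ {v} → v ∈ U → φ v ∈ S) → image φ U ⊆ S
image-⊆ φ {S = S} φU⊆S w∈ with v , v∈U , φv≡w ← ∈-image⁻ φ w∈ = subst (_∈ S) φv≡w (φU⊆S v∈U)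

elements : Subset m → List (Fin m)
elements U = filter (_∈? U) (allFin _)

elements-Unique : (U : Subset m) → Unique (elements U)
elements-Unique U = filter⁺ (_∈? U) (allFin⁺ _)

length-elements : (U : Subset m) → length (elements U) ≡ ∣ U ∣
length-elements U = trans (length-filter-∑ (_∈? U) (allFin _)) (∑-⟦∈⟧ U)

∈-elements⁺ : {U : Subset m} {v : Fin m} → v ∈ U → v ∈ˡ elements U
∈-elements⁺ {U = U} {v} = ∈-filter⁺ (_∈? U) (∈-allFin v)

∈-elements⁻ : {U : Subset m} {v : Fin m} → v ∈ˡ elements U → v ∈ U
∈-elements⁻ {U = U} v∈ = proj₂ (∈-filter⁻ (_∈? U) {xs = allFin _} v∈)

x∉S-x : (S : Subset n) (x : Fin n) → x ∉ S - x
x∉S-x (_ ∷ S) (suc x) x∈ = x∉S-x S x (drop-there x∈)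

-- Removal along a list, so that the growth bound can be applied to one vertex at a time.
removeAll : Subset m → List (Fin m) → Subset m
removeAll U []      = U
removeAll U (w ∷ X) = removeAll (U - w) X

removeAll-⊆ : (U : Subset m) (X : List (Fin m)) → removeAll U X ⊆ U
removeAll-⊆ U []      = id
removeAll-⊆ U (w ∷ X) = p─q⊆p U ⁅ w ⁆ ∘ removeAll-⊆ (U - w) X

∉-removeAll : (U : Subset m) {X : List (Fin m)} {w : Fin m} → w ∈ˡ X → w ∉ removeAll U X
∉-removeAll U {w ∷ X} (here refl) w∈ = x∉S-x U w (removeAll-⊆ (U - w) X w∈)
∉-removeAll U {v ∷ X} (there w∈X) w∈ = ∉-removeAll (U - v) w∈X w∈

-- Fixes `b` candidates in each `f v`, indexed by the same `Fin b`, so that choices of candidates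
-- become words over one alphabet.
enumerate : (S : Subset n) (b : ℕ) → b ≤ ∣ S ∣ →
  ∃[ g ] Injective _≡_ _≡_ g × (∀ (x : Fin b) → g x ∈ S)
enumerate S zero _ = (λ ()) , (λ {x} → contradiction x λ ()) , λ ()
enumerate (outside ∷ S) (suc b) b<∣S∣ with g , inj , g∈S ← enumerate S (suc b) b<∣S∣ =
  suc ∘ g , inj ∘ suc-injective , there ∘ g∈S
enumerate (inside ∷ S) (suc b) (s≤s b≤∣S∣) with g , inj , g∈S ← enumerate S b b≤∣S∣ = g′ , inj′ , g′∈
  where
  g′ : Fin (suc b) → Fin _
  g′ zero    = zero
  g′ (suc x) = suc (g x)
  inj′ : Injective _≡_ _≡_ g′
  inj′ {zero}  {zero}  _  = refl
  inj′ {suc x} {suc y} eq = cong suc (inj (suc-injective eq))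
  g′∈ : ∀ x → g′ x ∈ inside ∷ S
  g′∈ zero    = here
  g′∈ (suc x) = there (g∈S x)

-- Words read as choices of candidates

module _ (g : Fin m → Fin b → Fin n) where

  decode : Vec (Fin b) m → Fin m → Fin n
  decode χ v = g v (lookup χ v)

  -- Once the other coordinates are fixed, at most one of the `b` values at `v` hits the image of
  -- `w`, by injectivity of `g v`.
  ∑-collision : (∀ v → Injective _≡_ _≡_ (g v)) → {v w : Fin m} → w ≢ v →
    (F : Vec (Fin b) m → ℕ) → IgnoresCoordinate v F →
    b * (∑[ χ ← words b m ] F χ * ⟦ decode χ w ≟ decode χ v ⟧) ≤ ∑ (words b m) F
  ∑-collision g-inj {v} {w} w≢v F ign = begin
    b * (∑[ χ ← words b m ] F χ * ⟦ decode χ w ≟ decode χ v ⟧)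
      ≡⟨ cong (b *_) (∑-split-coordinate v _) ⟩
    b * (∑[ x ← allFin b ] ∑[ χ ← words b m ] ⟦ lookup χ v ≟ x ⟧ * (F χ * ⟦ decode χ w ≟ decode χ v ⟧))
      ≡⟨ cong (b *_) (∑-cong (allFin b) λ x → ∑-cong (words b m) λ χ → ⟦⟧*-cong (lookup χ v ≟ x)
           λ eq → cong (λ y → F χ * ⟦ decode χ w ≟ g v y ⟧) eq) ⟩
    b * (∑[ x ← allFin b ] ∑[ χ ← words b m ] ⟦ lookup χ v ≟ x ⟧ * (F χ * ⟦ decode χ w ≟ g v x ⟧))
      ≡⟨ sym (∑-*ˡ (allFin b) b _) ⟩
    ∑[ x ← allFin b ] b * (∑[ χ ← words b m ] ⟦ lookup χ v ≟ x ⟧ * (F χ * ⟦ decode χ w ≟ g v x ⟧))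
      ≡⟨ ∑-cong (allFin b) (λ x → ∑-fix-coordinate v (λ χ → F χ * ⟦ decode χ w ≟ g v x ⟧)
           (λ χ y → cong₂ _*_ (ign χ y) (cong (λ z → ⟦ g w z ≟ g v x ⟧) (lookup∘update′ w≢v χ y))) x) ⟩
    ∑[ x ← allFin b ] ∑[ χ ← words b m ] F χ * ⟦ decode χ w ≟ g v x ⟧
      ≡⟨ ∑-swap (allFin b) (words b m) _ ⟩
    ∑[ χ ← words b m ] ∑[ x ← allFin b ] F χ * ⟦ decode χ w ≟ g v x ⟧
      ≡⟨ ∑-cong (words b m) (λ χ → ∑-*ˡ (allFin b) (F χ) _) ⟩
    ∑[ χ ← words b m ] F χ * (∑[ x ← allFin b ] ⟦ decode χ w ≟ g v x ⟧)
      ≤⟨ ∑-mono (words b m) (λ χ → *-monoʳ-≤ (F χ)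
           (∑-⟦unique⟧≤1 (λ x → decode χ w ≟ g v x) λ p q → g-inj v (trans (sym p) q))) ⟩
    ∑[ χ ← words b m ] F χ * 1
      ≡⟨ ∑-cong (words b m) (λ χ → *-identityʳ (F χ)) ⟩
    ∑ (words b m) F ∎
    where open ≤-Reasoning

  module _ (G : Subset n → ℕ) where

    -- The summand of extensions G (length X) S picked out by decode χ on X:
    -- zero unless decode χ takes distinct values outside S on X.
    decodeExtension : List (Fin m) → Subset n → Vec (Fin b) m → ℕ
    decodeExtension []      S χ = G S
    decodeExtension (w ∷ X) S χ = ⟦ ¬? (decode χ w ∈? S) ⟧ * decodeExtension X (S ∪ ⁅ decode χ w ⁆) χ

    -- Independence, used for one vertex of `X` at a time: fixing its coordinate leaves a `1 / b`
    -- share of the sum of `F`. Its candidates are distinct vertices, so summing over them is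
    -- bounded by the sum over all vertices in `extensions`.
    ∑-decodeExtension : (∀ v → Injective _≡_ _≡_ (g v)) → {X : List (Fin m)} → Unique X →
      (F : Vec (Fin b) m → ℕ) → (∀ {w} → w ∈ˡ X → IgnoresCoordinate w F) → (S : Subset n) →
      b ^ length X * (∑[ χ ← words b m ] F χ * decodeExtension X S χ) ≤ extensions G (length X) S * ∑ (words b m) F
    ∑-decodeExtension g-inj {[]} _ F _ S = ≤-reflexive (begin
      1 * (∑[ χ ← words b m ] F χ * G S)    ≡⟨ *-identityˡ (∑[ χ ← words b m ] F χ * G S) ⟩
      ∑[ χ ← words b m ] F χ * G S          ≡⟨ ∑-*ʳ (words b m) (G S) F ⟩
      ∑ (words b m) F * G S                 ≡⟨ *-comm (∑ (words b m) F) (G S) ⟩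
      G S * ∑ (words b m) F                 ∎)
      where open ≡-Reasoning
    ∑-decodeExtension g-inj {w ∷ X} (w∉X ∷ uX) F ign S = begin
      b * b ^ j * (∑[ χ ← words b m ] F χ * H χ)
        ≡⟨ cong (b * b ^ j *_) (∑-split-coordinate w _) ⟩
      b * b ^ j * (∑[ x ← allFin b ] ∑[ χ ← words b m ] ⟦ lookup χ w ≟ x ⟧ * (F χ * H χ))
        ≡⟨ cong (b * b ^ j *_) (∑-cong (allFin b) λ x → trans (∑-cong (words b m) (isolate x)) (∑-*ˡ (words b m) (new x) _)) ⟩
      b * b ^ j * (∑[ x ← allFin b ] new x * R x)
        ≡⟨ sym (∑-*ˡ (allFin b) (b * b ^ j) _) ⟩
      ∑[ x ← allFin b ] b * b ^ j * (new x * R x)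
        ≡⟨ ∑-cong (allFin b) (λ x → trans (*-left-comm (b * b ^ j) (new x) (R x)) (cong (new x *_) (*-assoc b (b ^ j) (R x)))) ⟩
      ∑[ x ← allFin b ] new x * (b * (b ^ j * R x))
        ≤⟨ ∑-mono (allFin b) (λ x → *-monoʳ-≤ (new x) (*-monoʳ-≤ b
             (∑-decodeExtension g-inj uX (Fₓ x) (ignₓ x) (S ∪ ⁅ g w x ⁆)))) ⟩
      ∑[ x ← allFin b ] new x * (b * (T x * ∑ (words b m) (Fₓ x)))
        ≡⟨ ∑-cong (allFin b) (λ x → cong (new x *_) (trans (*-left-comm b (T x) _)
             (cong (T x *_) (∑-fix-coordinate w F (ign (here refl)) x)))) ⟩
      ∑[ x ← allFin b ] new x * (T x * ∑ (words b m) F)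
        ≡⟨ ∑-cong (allFin b) (λ x → sym (*-assoc (new x) (T x) _)) ⟩
      ∑[ x ← allFin b ] new x * T x * ∑ (words b m) F
        ≡⟨ ∑-*ʳ (allFin b) (∑ (words b m) F) _ ⟩
      (∑[ x ← allFin b ] new x * T x) * ∑ (words b m) F
        ≤⟨ *-monoˡ-≤ (∑ (words b m) F) (∑-injective (g-inj w) (λ y → ⟦ ¬? (y ∈? S) ⟧ * extensions G j (S ∪ ⁅ y ⁆))) ⟩
      extensions G (suc j) S * ∑ (words b m) F ∎
      where
      open ≤-Reasoning
      j : ℕ
      j = length X
      H : Vec (Fin b) m → ℕ
      H = decodeExtension (w ∷ X) S
      new T R : Fin b → ℕ
      new x = ⟦ ¬? (g w x ∈? S) ⟧
      T x = extensions G j (S ∪ ⁅ g w x ⁆)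
      -- Fixing coordinate `w` keeps independence from the remaining members of `X`, because `w`
      -- does not occur among them.
      Fₓ : Fin b → Vec (Fin b) m → ℕ
      Fₓ x χ = ⟦ lookup χ w ≟ x ⟧ * F χ
      R x = ∑[ χ ← words b m ] Fₓ x χ * decodeExtension X (S ∪ ⁅ g w x ⁆) χ
      ignₓ : ∀ x {v} → v ∈ˡ X → IgnoresCoordinate v (Fₓ x)
      ignₓ x v∈X χ y = cong₂ _*_
        (cong (λ z → ⟦ z ≟ x ⟧) (lookup∘update′ (All.lookup w∉X v∈X) χ y)) (ign (there v∈X) χ y)
      isolate : ∀ x χ → ⟦ lookup χ w ≟ x ⟧ * (F χ * H χ) ≡ new x * (Fₓ x χ * decodeExtension X (S ∪ ⁅ g w x ⁆) χ)
      isolate x χ = trans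
        (⟦⟧*-cong (lookup χ w ≟ x) λ eq → cong (λ z → F χ * (⟦ ¬? (g w z ∈? S) ⟧ * decodeExtension X (S ∪ ⁅ g w z ⁆) χ)) eq)
        (rearrange ⟦ lookup χ w ≟ x ⟧ (F χ) (new x) (decodeExtension X (S ∪ ⁅ g w x ⁆) χ))
        where
        rearrange : ∀ p q r s → p * (q * (r * s)) ≡ r * (p * q * s)
        rearrange = solve 4 (λ p q r s → p :* (q :* (r :* s)) := r :* (p :* q :* s)) refl
          where open +-*-Solver using (solve; _:*_; _:=_)

  module _ (A : Subset n) {Bad : Subset n → Set} (Bad? : Decidable Bad) where

    -- The starting set `S` is general so that values can be added one by one. Badness is assumed of
    -- every set containing `S` and the remaining values, a form that passes through the induction
    -- and applies to `S` itself at the end.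
    decodeExtension≡1 : (χ : Vec (Fin b) m) (X : List (Fin m)) → Unique X →
      (∀ v → decode χ v ∈ A) → (∀ {v w} → v ∈ˡ X → w ∈ˡ X → decode χ v ≡ decode χ w → v ≡ w) →
      (S : Subset n) → S ⊆ A → (∀ {v} → v ∈ˡ X → decode χ v ∉ S) →
      (∀ S′ → S ⊆ S′ → (∀ {v} → v ∈ˡ X → decode χ v ∈ S′) → Bad S′) →
      decodeExtension (badWithin A Bad?) X S χ ≡ 1
    decodeExtension≡1 χ [] _ χ∈A inj S S⊆A S∌ bad =
      ⟦⟧-yes (Bad? S ×-dec (S ⊆? A)) (bad S id (λ ()) , S⊆A)
    decodeExtension≡1 χ (w ∷ X) (w∉X ∷ uX) χ∈A inj S S⊆A S∌ bad = cong₂ _*_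
      (⟦⟧-yes (¬? (decode χ w ∈? S)) (S∌ (here refl)))
      (decodeExtension≡1 χ X uX χ∈A (λ v∈ u∈ → inj (there v∈) (there u∈)) (S ∪ ⁅ decode χ w ⁆)
        (∪⁅⁆-⊆ S⊆A (χ∈A w))
        (λ {v} v∈X χv∈ → case x∈p∪q⁻ S ⁅ decode χ w ⁆ χv∈ of λ where
          (inj₁ χv∈S) → S∌ (there v∈X) χv∈S
          (inj₂ χv∈w) → All.lookup w∉X v∈X (inj (here refl) (there v∈X) (sym (x∈⁅y⁆⇒x≡y _ χv∈w))))
        λ S′ S∪w⊆S′ X⊆S′ → bad S′ (S∪w⊆S′ ∘ p⊆p∪q ⁅ decode χ w ⁆) λ where
          (here refl) → S∪w⊆S′ (x∈S∪⁅x⁆ S (decode χ w))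
          (there v∈X) → X⊆S′ v∈X)

-- The growth of the number of valid choices

^-distribʳ-* : ∀ j x y → (x * y) ^ j ≡ x ^ j * y ^ j
^-distribʳ-* zero    x y = refl
^-distribʳ-* (suc j) x y = trans (cong (x * y *_) (^-distribʳ-* j x y)) (*-interchange x y (x ^ j) (y ^ j))

≤maximum : (h : Fin n → ℕ) (i : Fin n) → h i ≤ maximum h
≤maximum h i = go (∈-allFin i)
  where
  go : ∀ {xs} → i ∈ˡ xs → h i ≤ foldr _⊔_ 0 (map h xs)
  go (here refl) = m≤m⊔n (h i) _
  go {x ∷ _} (there i∈) = ≤-trans (go i∈) (m≤n⊔m (h x) _)

maximum≤ : (h : Fin n → ℕ) {c : ℕ} → (∀ i → h i ≤ c) → maximum h ≤ c
maximum≤ {n} h {c} h≤c = go (allFin n)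
  where
  go : ∀ xs → foldr _⊔_ 0 (map h xs) ≤ c
  go []       = z≤n
  go (x ∷ xs) = ⊔-lub (h≤c x) (go xs)

N⁺-antitone : (T : Tournament n) {S S′ : Subset n} → S ⊆ S′ → N⁺ T S′ ⊆ N⁺ T S
N⁺-antitone T {S} {S′} S⊆S′ w∈ = ∈-subset⁺ (λ w → all? λ s → (s ∈? S) →-dec (s ⟶? w))
  λ s s∈S → ∈-subset⁻ (λ w → all? λ s → (s ∈? S′) →-dec (s ⟶? w)) w∈ s (S⊆S′ s∈S)
  where open Tournament T

Δ⁻≤∣V₁∣ : (D : BipartiteDigraph m k) → Δ⁻ D ≤ m
Δ⁻≤∣V₁∣ D = maximum≤ (λ u → ∣ inNbhd D u ∣) λ u → ∣p∣≤n (inNbhd D u)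

-- Without outgoing edges every in-neighbourhood would be empty. This keeps the denominator in the
-- bound on `δ` nonzero.
Δ⁻>0⇒Δ⁺>0 : (D : BipartiteDigraph m k) → Δ⁻ D > 0 → Δ⁺ D > 0
Δ⁻>0⇒Δ⁺>0 {m} {k} D Δ⁻>0 = ≰⇒> λ Δ⁺≤0 → <⇒≱ Δ⁻>0 (maximum≤ (λ u → ∣ inNbhd D u ∣) λ u →
  ≤-reflexive (trans (cong ∣_∣ (Empty-unique λ (v , v∈N) →
    n≮0 (<-≤-trans (nonempty (∈-subset⁺ (λ u → v ⟶? u) (∈-subset⁻ (λ w → w ⟶? u) v∈N)))
      (≤-trans (≤maximum (λ v → ∣ outNbhd D v ∣) v) Δ⁺≤0)))) (∣⊥∣≡0 m)))
  where
  open BipartiteDigraph D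
  nonempty : ∀ {u} {S : Subset k} → u ∈ S → 0 < ∣ S ∣
  nonempty {u} u∈S = subst (_≤ _) (∣⁅x⁆∣≡1 u) (p⊆q⇒∣p∣≤∣q∣ λ x∈ → subst (_∈ _) (sym (x∈⁅y⁆⇒x≡y u x∈)) u∈S)

-- For nonzero `x` this is `(y/x)^j ≤ (y/x)^d` with denominators cleared; the powers differ by
-- `d ∸ j` factors, each at least as large for `y`.
^-exchange-≤ : ∀ {x y j d} → x ≤ y → j ≤ d → y ^ j * x ^ d ≤ x ^ j * y ^ d
^-exchange-≤ {x} {y} {j} {d} x≤y j≤d = begin
  y ^ j * x ^ d                ≡⟨ cong (λ d → y ^ j * x ^ d) (sym (m+[n∸m]≡n j≤d)) ⟩
  y ^ j * x ^ (j + (d ∸ j))    ≡⟨ cong (y ^ j *_) (^-distribˡ-+-* x j (d ∸ j)) ⟩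
  y ^ j * (x ^ j * x ^ (d ∸ j)) ≡⟨ *-left-comm (y ^ j) (x ^ j) _ ⟩
  x ^ j * (y ^ j * x ^ (d ∸ j)) ≤⟨ *-monoʳ-≤ (x ^ j) (*-monoʳ-≤ (y ^ j) (^-monoˡ-≤ (d ∸ j) x≤y)) ⟩
  x ^ j * (y ^ j * y ^ (d ∸ j)) ≡⟨ cong (x ^ j *_) (sym (^-distribˡ-+-* y j (d ∸ j))) ⟩
  x ^ j * y ^ (j + (d ∸ j))    ≡⟨ cong (λ d → x ^ j * y ^ d) (m+[n∸m]≡n j≤d) ⟩
  x ^ j * y ^ d                ∎
  where open ≤-Reasoning

-- Chaining the three bounds gives `K * R ≤ (5b/7a)^(d-j) * P`, and the ratio `5b/7a` is at most 1.
-- Here `R` counts the spoilt choices at one vertex and `t` the bad tuples.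
spoilt-arithmetic : ∀ {a b d j K t R P′ P} .{{_ : NonZero b}} → b ≤ a → j ≤ d →
  t * (K * (7 * a) ^ d) ≤ a ^ j * (5 * b) ^ d → b ^ j * R ≤ t * P′ → 5 ^ j * P′ ≤ 7 ^ j * P → K * R ≤ P
spoilt-arithmetic {a} {b} {d} {j} {K} {t} {R} {P′} {P} b≤a j≤d t-bound R-bound P′-bound =
  *-cancelˡ-≤ (x ^ j * y ^ d) {{m*n≢0 (x ^ j) (y ^ d) {{m^n≢0 x j {{m*n≢0 5 b}}}} {{m^n≢0 y d {{m*n≢0 7 a {{_}} {{a≢0}}}}}}}} (begin
    x ^ j * y ^ d * (K * R)                ≡⟨ cong (λ z → z * y ^ d * (K * R)) (^-distribʳ-* j 5 b) ⟩
    5 ^ j * b ^ j * y ^ d * (K * R)        ≡⟨ solve 5 (λ p q r s t → p :* q :* r :* (s :* t) := (q :* t) :* (p :* (s :* r))) refl (5 ^ j) (b ^ j) (y ^ d) K R ⟩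
    b ^ j * R * (5 ^ j * (K * y ^ d))      ≤⟨ *-monoˡ-≤ (5 ^ j * (K * y ^ d)) R-bound ⟩
    t * P′ * (5 ^ j * (K * y ^ d))         ≡⟨ solve 4 (λ p q r s → p :* q :* (r :* s) := (p :* s) :* (r :* q)) refl t P′ (5 ^ j) (K * y ^ d) ⟩
    t * (K * y ^ d) * (5 ^ j * P′)         ≤⟨ *-mono-≤ t-bound P′-bound ⟩
    a ^ j * x ^ d * (7 ^ j * P)            ≡⟨ solve 4 (λ p q r s → p :* q :* (r :* s) := r :* p :* q :* s) refl (a ^ j) (x ^ d) (7 ^ j) P ⟩
    7 ^ j * a ^ j * x ^ d * P              ≡⟨ cong (λ z → z * x ^ d * P) (sym (^-distribʳ-* j 7 a)) ⟩
    y ^ j * x ^ d * P                      ≤⟨ *-monoˡ-≤ P (^-exchange-≤ (*-mono-≤ (toWitness {a? = 5 ≤? 7} _) b≤a) j≤d) ⟩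
    x ^ j * y ^ d * P                      ∎)
  where
  open ≤-Reasoning
  open +-*-Solver using (solve; _:*_; _:=_)
  x y : ℕ
  x = 5 * b
  y = 7 * a
  a≢0 : NonZero a
  a≢0 = >-nonZero (<-≤-trans (>-nonZero⁻¹ b) b≤a)

-- Since `1 - 1/32 - 1/4 = 23/32` and `7 * 23 = 161 ≥ 160 = 5 * 32`. Everything is scaled by
-- `224 = 7 * 32`; the scaled loss `63 * P` is added to both sides to avoid subtraction.
loss-arithmetic : ∀ {P P′ C R} → P ≤ P′ + C + R → 32 * C ≤ P → 4 * R ≤ P → 5 * P ≤ 7 * P′
loss-arithmetic {P} {P′} {C} {R} loss 32C≤P 4R≤P = *-cancelˡ-≤ 32 (+-cancelʳ-≤ (63 * P) _ _ (begin
  32 * (5 * P) + 63 * P                          ≡⟨ solve 1 (λ p → con 32 :* (con 5 :* p) :+ con 63 :* p := con 223 :* p) refl P ⟩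
  223 * P                                        ≤⟨ *-monoˡ-≤ P (n≤1+n 223) ⟩
  224 * P                                        ≤⟨ *-monoʳ-≤ 224 loss ⟩
  224 * (P′ + C + R)                             ≡⟨ solve 3 (λ p c r → con 224 :* (p :+ c :+ r) := con 32 :* (con 7 :* p) :+ (con 7 :* (con 32 :* c) :+ con 56 :* (con 4 :* r))) refl P′ C R ⟩
  32 * (7 * P′) + (7 * (32 * C) + 56 * (4 * R))  ≤⟨ +-monoʳ-≤ (32 * (7 * P′)) (+-mono-≤ (*-monoʳ-≤ 7 32C≤P) (*-monoʳ-≤ 56 4R≤P)) ⟩
  32 * (7 * P′) + (7 * P + 56 * P)               ≡⟨ cong (32 * (7 * P′) +_) (sym (*-distribʳ-+ P 7 56)) ⟩
  32 * (7 * P′) + 63 * P                         ∎))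
  where
  open ≤-Reasoning
  open +-*-Solver using (solve; con; _:+_; _:*_; _:=_)

injective-∪⁅⁆ : {U : Subset m} {v : Fin m} {φ : Fin m → Fin n} →
  (∀ w w′ → w ∈ U → w′ ∈ U → φ w ≡ φ w′ → w ≡ w′) → ¬ (∃[ w ] w ∈ U × φ w ≡ φ v) →
  ∀ w w′ → w ∈ U ∪ ⁅ v ⁆ → w′ ∈ U ∪ ⁅ v ⁆ → φ w ≡ φ w′ → w ≡ w′
injective-∪⁅⁆ {U = U} {v} inj distinct w w′ w∈ w′∈ eq with x∈p∪q⁻ U ⁅ v ⁆ w∈ | x∈p∪q⁻ U ⁅ v ⁆ w′∈
... | inj₁ w∈U | inj₁ w′∈U = inj w w′ w∈U w′∈U eq
... | inj₁ w∈U | inj₂ w′∈v rewrite x∈⁅y⁆⇒x≡y v w′∈v = contradiction (w , w∈U , eq) distinct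
... | inj₂ w∈v | inj₁ w′∈U rewrite x∈⁅y⁆⇒x≡y v w∈v = contradiction (w′ , w′∈U , sym eq) distinct
... | inj₂ w∈v | inj₂ w′∈v = trans (x∈⁅y⁆⇒x≡y v w∈v) (sym (x∈⁅y⁆⇒x≡y v w′∈v))

-- Valid choices and the ways to lose one

module _
  (D : BipartiteDigraph m k)
  (A : Subset n) {Bad : Subset n → Set} (Bad? : Decidable Bad)
  (Bad-mono : ∀ {S S′} → S ⊆ S′ → Bad S → Bad S′)
  (g : Fin m → Fin b → Fin n)
  where

  -- Constraining `u` only when its whole in-neighbourhood lies in `U` makes validity depend on the
  -- coordinates in `U` alone; for `U = ⊤` every `u` is constrained.
  Valid : Subset m → Vec (Fin b) m → Set
  Valid U χ = (∀ v w → v ∈ U → w ∈ U → decode g χ v ≡ decode g χ w → v ≡ w)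
            × (∀ u → inNbhd D u ⊆ U → ¬ Bad (image (decode g χ) (inNbhd D u)))

  -- Abstract so that case analyses on validity find it un-normalised in their goals.
  abstract
    Valid? : ∀ U → Decidable (Valid U)
    Valid? U χ =
      (all? λ v → all? λ w → (v ∈? U) →-dec ((w ∈? U) →-dec ((decode g χ v ≟ decode g χ w) →-dec (v ≟ w))))
      ×-dec (all? λ u → (inNbhd D u ⊆? U) →-dec ¬? (Bad? (image (decode g χ) (inNbhd D u))))

  Valid-antitone : ∀ {U U′ χ} → U ⊆ U′ → Valid U′ χ → Valid U χ
  Valid-antitone U⊆U′ (inj , good) =
    (λ v w v∈U w∈U → inj v w (U⊆U′ v∈U) (U⊆U′ w∈U)) , λ u N⊆U → good u (U⊆U′ ∘ N⊆U)

  Valid-agree : ∀ {U χ χ′} → (∀ {v} → v ∈ U → decode g χ v ≡ decode g χ′ v) → Valid U χ → Valid U χ′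
  Valid-agree {U} {χ} {χ′} agree (inj , good) =
    (λ v w v∈U w∈U eq → inj v w v∈U w∈U (trans (agree v∈U) (trans eq (sym (agree w∈U))))) ,
    -- The two images are compared only by inclusion, along which badness is transported.
    λ u N⊆U → good u N⊆U ∘ Bad-mono (image-⊆ (decode g χ′) λ {v} v∈N →
      subst (_∈ image (decode g χ) (inNbhd D u)) (agree (N⊆U v∈N)) (∈-image⁺ (decode g χ) v∈N))

  Valid-ignores : ∀ {U v} → v ∉ U → IgnoresCoordinate v (λ χ → ⟦ Valid? U χ ⟧)
  Valid-ignores {U} {v} v∉U χ x = ⟦⟧-cong (Valid? U (χ [ v ]≔ x)) (Valid? U χ)
    (Valid-agree {χ = χ [ v ]≔ x} {χ} unchanged)
    (Valid-agree {χ = χ} {χ [ v ]≔ x} λ w∈U → sym (unchanged w∈U))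
    where
    unchanged : ∀ {w} → w ∈ U → decode g (χ [ v ]≔ x) w ≡ decode g χ w
    unchanged {w} w∈U = cong (g w) (lookup∘update′ (λ w≡v → v∉U (subst (_∈ U) w≡v w∈U)) χ x)

  -- The quantity `P(U)` of the overview, out of `b ^ m` words.
  count : Subset m → ℕ
  count U = ∑[ χ ← words b m ] ⟦ Valid? U χ ⟧

  count-antitone : ∀ {U U′} → U ⊆ U′ → count U′ ≤ count U
  count-antitone {U} {U′} U⊆U′ = ∑-mono (words b m) λ χ →
    ⟦⟧-mono (Valid? U′ χ) (Valid? U χ) (Valid-antitone {χ = χ} U⊆U′)

  Grows : Subset m → Set
  Grows U = ∀ v → 5 * count U ≤ 7 * count (U ∪ ⁅ v ⁆)

  -- Growth read backwards: removing a vertex of `U` multiplies the count by at most 7/5, as growth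
  -- applies to the smaller set left over. A vertex outside `U` changes nothing when removed.
  count-removeAll : ∀ U → (∀ U′ → ∣ U′ ∣ < ∣ U ∣ → Grows U′) → (X : List (Fin m)) →
    5 ^ length X * count (removeAll U X) ≤ 7 ^ length X * count U
  count-removeAll U grows []      = ≤-refl
  count-removeAll U grows (w ∷ X) = begin
    5 * 5 ^ length X * count (removeAll (U - w) X)    ≡⟨ *-assoc 5 (5 ^ length X) _ ⟩
    5 * (5 ^ length X * count (removeAll (U - w) X))  ≤⟨ *-monoʳ-≤ 5 (count-removeAll (U - w) smaller X) ⟩
    5 * (7 ^ length X * count (U - w))                ≡⟨ *-left-comm 5 (7 ^ length X) _ ⟩
    7 ^ length X * (5 * count (U - w))                ≤⟨ *-monoʳ-≤ (7 ^ length X) removeOne ⟩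
    7 ^ length X * (7 * count U)                      ≡⟨ *-left-comm (7 ^ length X) 7 _ ⟩
    7 * (7 ^ length X * count U)                      ≡⟨ sym (*-assoc 7 (7 ^ length X) _) ⟩
    7 * 7 ^ length X * count U                        ∎
    where
    open ≤-Reasoning
    smaller : ∀ U′ → ∣ U′ ∣ < ∣ U - w ∣ → Grows U′
    smaller U′ lt = grows U′ (<-≤-trans lt (p⊆q⇒∣p∣≤∣q∣ (p─q⊆p U ⁅ w ⁆)))
    U⊆U-w∪w : U ⊆ (U - w) ∪ ⁅ w ⁆
    U⊆U-w∪w {x} x∈U with x ≟ w
    ... | yes refl = x∈S∪⁅x⁆ (U - w) w
    ... | no x≢w   = p⊆p∪q ⁅ w ⁆ (x∈p∧x≢y⇒x∈p-y x∈U x≢w)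
    removeOne : 5 * count (U - w) ≤ 7 * count U
    removeOne with w ∈? U
    ... | yes w∈U = ≤-trans (grows (U - w) (x∈p⇒∣p-x∣<∣p∣ w∈U) w)
      (*-monoʳ-≤ 7 (count-antitone U⊆U-w∪w))
    ... | no w∉U = *-mono-≤ (toWitness {a? = 5 ≤? 7} _)
      (count-antitone λ {x} x∈U → x∈p∧x≢y⇒x∈p-y x∈U λ x≡w → w∉U (subst (_∈ U) x≡w x∈U))

  module _ (U : Subset m) where

    rest : Fin k → Subset m
    rest u = removeAll U (elements (inNbhd D u))

    -- Validity is asked only away from the in-neighbourhood of `u`. This overcounts the choices
    -- lost at `u`, but makes the first factor independent of the values on that neighbourhood.
    spoilt : Fin k → Vec (Fin b) m → ℕ
    spoilt u χ = ⟦ Valid? (rest u) χ ⟧ * decodeExtension g (badWithin A Bad?) (elements (inNbhd D u)) ⊥ χ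

  module _ (U : Subset m) (v : Fin m) where

    collisions : Fin m → ℕ
    collisions w = ∑[ χ ← words b m ] ⟦ Valid? U χ ⟧ * ⟦ decode g χ w ≟ decode g χ v ⟧

    -- A pointwise union bound. A choice valid on `U` but not on `U ∪ ⁅ v ⁆` either repeats at `v` a
    -- value taken on `U`, or is injective there and has a bad image at some `u`.
    loss-cover : (∀ w x → g w x ∈ A) → ∀ χ → ⟦ Valid? U χ ⟧ ≤ ⟦ Valid? (U ∪ ⁅ v ⁆) χ ⟧
      + (∑[ w ← allFin m ] ⟦ w ∈? U ⟧ * (⟦ Valid? U χ ⟧ * ⟦ decode g χ w ≟ decode g χ v ⟧))
      + (∑[ u ← allFin k ] ⟦ u ∈? outNbhd D v ⟧ * spoilt U u χ)
    loss-cover g∈A χ with Valid? U χ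
    ... | no _ = z≤n
    ... | yes valid@(inj , good) with Valid? (U ∪ ⁅ v ⁆) χ
    ... | yes _ = s≤s z≤n
    ... | no ¬valid with any? (λ w → (w ∈? U) ×-dec (decode g χ w ≟ decode g χ v))
    ... | yes (w , w∈U , eq) = ≤-trans
      (≤-trans
        (≤-reflexive (sym (cong₂ (λ p q → p * (1 * q)) (⟦⟧-yes (w ∈? U) w∈U) (⟦⟧-yes (decode g χ w ≟ decode g χ v) eq))))
        (∑-≥-term (λ w → ⟦ w ∈? U ⟧ * (1 * ⟦ decode g χ w ≟ decode g χ v ⟧)) (∈-allFin w)))
      (m≤m+n _ _)
    ... | no distinct with any? (λ u → (inNbhd D u ⊆? U ∪ ⁅ v ⁆) ×-dec Bad? (image (decode g χ) (inNbhd D u)))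
    ... | no none = contradiction (injective-∪⁅⁆ inj distinct , λ u N⊆ bad → none (u , (λ {x} → N⊆ {x}) , bad)) ¬valid
    ... | yes (u , N⊆ , bad) = ≤-trans
      (≤-trans (≤-reflexive (sym (cong₂ _*_ (⟦⟧-yes (u ∈? outNbhd D v) u∈N⁺v) spoilt≡1)))
        (∑-≥-term (λ u → ⟦ u ∈? outNbhd D v ⟧ * spoilt U u χ) (∈-allFin u)))
      (m≤n+m _ _)
      where
      open BipartiteDigraph D
      -- Otherwise the in-neighbourhood of `u` lies in `U` already, where validity on `U` forbids a
      -- bad image.
      v∈N : v ∈ inNbhd D u
      v∈N with v ∈? inNbhd D u
      ... | yes v∈ = v∈
      ... | no v∉  = contradiction bad (good u λ {x} x∈N → case x∈p∪q⁻ U ⁅ v ⁆ (N⊆ x∈N) of λ where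
        (inj₁ x∈U) → x∈U
        (inj₂ x∈v) → contradiction (subst (_∈ inNbhd D u) (x∈⁅y⁆⇒x≡y v x∈v) x∈N) v∉)
      u∈N⁺v : u ∈ outNbhd D v
      u∈N⁺v = ∈-subset⁺ (λ u → v ⟶? u) (∈-subset⁻ (λ w → w ⟶? u) v∈N)
      spoilt≡1 : spoilt U u χ ≡ 1
      spoilt≡1 = cong₂ _*_
        (⟦⟧-yes (Valid? (rest U u) χ) (Valid-antitone {χ = χ} (removeAll-⊆ U (elements (inNbhd D u))) valid))
        (decodeExtension≡1 g A Bad? χ (elements (inNbhd D u)) (elements-Unique (inNbhd D u))
          (λ w → g∈A w (lookup χ w))
          (λ {w} {w′} w∈ w′∈ → injective-∪⁅⁆ inj distinct w w′ (N⊆ (∈-elements⁻ w∈)) (N⊆ (∈-elements⁻ w′∈)))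
          ⊥ ⊥⊆ (λ _ → ∉⊥)
          λ S′ _ N⊆S′ → Bad-mono (image-⊆ (decode g χ) λ w∈N → N⊆S′ (∈-elements⁺ w∈N)) bad)

    count-loss : (∀ w x → g w x ∈ A) → count U ≤ count (U ∪ ⁅ v ⁆)
      + (∑[ w ← allFin m ] ⟦ w ∈? U ⟧ * collisions w)
      + (∑[ u ← allFin k ] ⟦ u ∈? outNbhd D v ⟧ * ∑ (words b m) (spoilt U u))
    count-loss g∈A = begin
      count U
        ≤⟨ ∑-mono W (loss-cover g∈A) ⟩
      ∑[ χ ← W ] (⟦ Valid? (U ∪ ⁅ v ⁆) χ ⟧ + (∑[ w ← allFin m ] ⟦ w ∈? U ⟧ * collision w χ) + (∑[ u ← allFin k ] ⟦ u ∈? outNbhd D v ⟧ * spoilt U u χ))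
        ≡⟨ ∑-+ W (λ χ → ⟦ Valid? (U ∪ ⁅ v ⁆) χ ⟧ + (∑[ w ← allFin m ] ⟦ w ∈? U ⟧ * collision w χ)) _ ⟩
      (∑[ χ ← W ] (⟦ Valid? (U ∪ ⁅ v ⁆) χ ⟧ + (∑[ w ← allFin m ] ⟦ w ∈? U ⟧ * collision w χ))) + (∑[ χ ← W ] ∑[ u ← allFin k ] ⟦ u ∈? outNbhd D v ⟧ * spoilt U u χ)
        ≡⟨ cong₂ _+_ (trans (∑-+ W (λ χ → ⟦ Valid? (U ∪ ⁅ v ⁆) χ ⟧) _)
             (cong (count (U ∪ ⁅ v ⁆) +_) (interchange (allFin m) (λ w → ⟦ w ∈? U ⟧) collision)))
             (interchange (allFin k) (λ u → ⟦ u ∈? outNbhd D v ⟧) (spoilt U)) ⟩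
      count (U ∪ ⁅ v ⁆) + (∑[ w ← allFin m ] ⟦ w ∈? U ⟧ * collisions w) + (∑[ u ← allFin k ] ⟦ u ∈? outNbhd D v ⟧ * ∑ W (spoilt U u)) ∎
      where
      open ≤-Reasoning
      W : List (Vec (Fin b) m)
      W = words b m
      collision : Fin m → Vec (Fin b) m → ℕ
      collision w χ = ⟦ Valid? U χ ⟧ * ⟦ decode g χ w ≟ decode g χ v ⟧
      interchange : ∀ {Y : Set} (ys : List Y) (i : Y → ℕ) (f : Y → Vec (Fin b) m → ℕ) →
        ∑[ χ ← W ] ∑[ y ← ys ] i y * f y χ ≡ ∑[ y ← ys ] i y * ∑ W (f y)
      interchange ys i f = trans (∑-swap W ys _) (∑-cong ys λ y → ∑-*ˡ W (i y) (f y))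

  -- The growth induction under the numerical hypotheses

  module _ (a d Δ : ℕ) .{{_ : NonZero Δ}} .{{_ : NonZero b}} .{{_ : NonZero m}}
    (g-inj : ∀ v → Injective _≡_ _≡_ (g v)) (g∈A : ∀ v x → g v x ∈ A)
    (b≤a : b ≤ a) (32m≤b : 32 * m ≤ b)
    (inDeg≤d : ∀ u → ∣ inNbhd D u ∣ ≤ d) (outDeg≤Δ : ∀ v → ∣ outNbhd D v ∣ ≤ Δ)
    (few : ∀ {j} → j ≤ d → extensions (badWithin A Bad?) j ⊥ * (4 * Δ * (7 * a) ^ d) ≤ a ^ j * (5 * b) ^ d)
    where

    -- Validity on `rest U u` ignores the coordinates of the in-neighbours of `u`, so the two
    -- factors of `spoilt` separate. `few` bounds the bad tuples, and the growth hypothesis compares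
    -- `count (rest U u)` with `count U`.
    spoilt-bound : ∀ U → (∀ U′ → ∣ U′ ∣ < ∣ U ∣ → Grows U′) → ∀ u → 4 * Δ * ∑ (words b m) (spoilt U u) ≤ count U
    spoilt-bound U grows u = spoilt-arithmetic {a} {b} {d} {length N} {4 * Δ} {extensions (badWithin A Bad?) (length N) ⊥}
      b≤a j≤d (few j≤d)
      (∑-decodeExtension g (badWithin A Bad?) g-inj (elements-Unique (inNbhd D u)) (λ χ → ⟦ Valid? (rest U u) χ ⟧)
        (λ w∈N → Valid-ignores (∉-removeAll U w∈N)) ⊥)
      (count-removeAll U grows N)
      where
      N : List (Fin m)
      N = elements (inNbhd D u)
      j≤d : length N ≤ d
      j≤d = subst (_≤ d) (sym (length-elements (inNbhd D u))) (inDeg≤d u)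

    spoilt-total : ∀ U → (∀ U′ → ∣ U′ ∣ < ∣ U ∣ → Grows U′) → ∀ v →
      4 * (∑[ u ← allFin k ] ⟦ u ∈? outNbhd D v ⟧ * ∑ (words b m) (spoilt U u)) ≤ count U
    spoilt-total U grows v = *-cancelˡ-≤ Δ (begin
      Δ * (4 * (∑[ u ← allFin k ] i u * R u))   ≡⟨ solve 2 (λ p q → p :* (con 4 :* q) := con 4 :* p :* q) refl Δ _ ⟩
      4 * Δ * (∑[ u ← allFin k ] i u * R u)     ≡⟨ sym (∑-*ˡ (allFin k) (4 * Δ) _) ⟩
      ∑[ u ← allFin k ] 4 * Δ * (i u * R u)     ≡⟨ ∑-cong (allFin k) (λ u → *-left-comm (4 * Δ) (i u) (R u)) ⟩
      ∑[ u ← allFin k ] i u * (4 * Δ * R u)     ≤⟨ ∑-mono (allFin k) (λ u → *-monoʳ-≤ (i u) (spoilt-bound U grows u)) ⟩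
      ∑[ u ← allFin k ] i u * count U           ≡⟨ ∑-*ʳ (allFin k) (count U) i ⟩
      ∑ (allFin k) i * count U                  ≡⟨ cong (_* count U) (∑-⟦∈⟧ (outNbhd D v)) ⟩
      ∣ outNbhd D v ∣ * count U                 ≤⟨ *-monoˡ-≤ (count U) (outDeg≤Δ v) ⟩
      Δ * count U                               ∎)
      where
      open ≤-Reasoning
      open +-*-Solver using (solve; con; _:*_; _:=_)
      i R : Fin k → ℕ
      i u = ⟦ u ∈? outNbhd D v ⟧
      R u = ∑ (words b m) (spoilt U u)

    -- As `v ∉ U`, validity on `U` ignores coordinate `v`, so each of at most `m` vertices accounts
    -- for at most a `1 / b` share of the count.
    collision-total : ∀ U {v} → v ∉ U → 32 * (∑[ w ← allFin m ] ⟦ w ∈? U ⟧ * collisions U v w) ≤ count U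
    collision-total U {v} v∉U = *-cancelˡ-≤ m (begin
      m * (32 * (∑[ w ← allFin m ] i w * C w))  ≡⟨ solve 2 (λ p q → p :* (con 32 :* q) := con 32 :* p :* q) refl m _ ⟩
      32 * m * (∑[ w ← allFin m ] i w * C w)    ≤⟨ *-monoˡ-≤ (∑[ w ← allFin m ] i w * C w) 32m≤b ⟩
      b * (∑[ w ← allFin m ] i w * C w)         ≡⟨ sym (∑-*ˡ (allFin m) b _) ⟩
      ∑[ w ← allFin m ] b * (i w * C w)         ≤⟨ ∑-mono (allFin m) bound ⟩
      ∑[ w ← allFin m ] count U                 ≡⟨ ∑-const (allFin m) (count U) ⟩
      length (allFin m) * count U               ≡⟨ cong (_* count U) (length-allFin m) ⟩
      m * count U                               ∎)
      where
      open ≤-Reasoning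
      open +-*-Solver using (solve; con; _:*_; _:=_)
      i C : Fin m → ℕ
      i w = ⟦ w ∈? U ⟧
      C = collisions U v
      bound : ∀ w → b * (i w * C w) ≤ count U
      bound w = begin
        b * (i w * C w)    ≡⟨ *-left-comm b (i w) (C w) ⟩
        i w * (b * C w)    ≤⟨ ⟦⟧*-mono (w ∈? U) (λ w∈U → ∑-collision g g-inj (λ w≡v → v∉U (subst (_∈ U) w≡v w∈U)) _ (Valid-ignores v∉U)) ⟩
        i w * count U      ≤⟨ *-monoˡ-≤ (count U) (⟦⟧≤1 (w ∈? U)) ⟩
        1 * count U        ≡⟨ *-identityˡ (count U) ⟩
        count U            ∎

    -- Strong induction on `∣ U ∣`, because bounding the spoilt choices uses growth at smaller sets.
    -- If `v` already lies in `U`, the count does not drop.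
    count-grows : ∀ U → Grows U
    count-grows U = <-rec (λ s → ∀ U → ∣ U ∣ ≡ s → Grows U) step ∣ U ∣ U refl
      where
      step : ∀ s → (∀ {s′} → s′ < s → ∀ U → ∣ U ∣ ≡ s′ → Grows U) → ∀ U → ∣ U ∣ ≡ s → Grows U
      step _ rec U refl v with v ∈? U
      ... | yes v∈U = *-mono-≤ (toWitness {a? = 5 ≤? 7} _) (count-antitone (∪⁅⁆-⊆ id v∈U))
      ... | no v∉U = loss-arithmetic {count U} {count (U ∪ ⁅ v ⁆)}
        {∑[ w ← allFin m ] ⟦ w ∈? U ⟧ * collisions U v w}
        {∑[ u ← allFin k ] ⟦ u ∈? outNbhd D v ⟧ * ∑ (words b m) (spoilt U u)}
        (count-loss U v g∈A) (collision-total U v∉U)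
        (spoilt-total U (λ U′ lt → rec lt U′ refl) v)

    -- Inserting the vertices one at a time keeps the count positive, as each step retains at least
    -- a 5/7 share.
    count-⊤>0 : count ⊥ > 0 → count ⊤ > 0
    count-⊤>0 count⊥>0 = <-≤-trans (along (allFin m))
      (count-antitone λ {v} _ → ∈-insertAll (∈-allFin v))
      where
      insertAll : List (Fin m) → Subset m
      insertAll []      = ⊥
      insertAll (v ∷ X) = insertAll X ∪ ⁅ v ⁆
      ∈-insertAll : ∀ {v X} → v ∈ˡ X → v ∈ insertAll X
      ∈-insertAll {X = w ∷ X} (here refl) = x∈S∪⁅x⁆ (insertAll X) w
      ∈-insertAll {X = w ∷ X} (there v∈X) = p⊆p∪q ⁅ w ⁆ (∈-insertAll v∈X)
      along : ∀ X → count (insertAll X) > 0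
      along []      = count⊥>0
      along (v ∷ X) = *-cancelˡ-< 7 0 _ (<-≤-trans (*-monoʳ-< 5 (along X)) (count-grows (insertAll X) v))

    -- A bad empty set would make the only 0-tuple bad, and `few` at `j = 0` would give
    -- `4 * Δ * (7 * a) ^ d ≤ (5 * b) ^ d`, against `b ≤ a`. This settles the vertices `u` without
    -- in-neighbours.
    ¬Bad-⊥ : ¬ Bad ⊥
    ¬Bad-⊥ bad = <-irrefl refl (begin-strict
      (7 * a) ^ d                                       <⟨ m<m*n ((7 * a) ^ d) (4 * Δ) {{m^n≢0 (7 * a) d {{m*n≢0 7 a {{_}} {{a≢0}}}}}} (≤-trans (toWitness {a? = 2 ≤? 4} _) (m≤m*n 4 Δ)) ⟩
      (7 * a) ^ d * (4 * Δ)                             ≡⟨ *-comm ((7 * a) ^ d) (4 * Δ) ⟩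
      4 * Δ * (7 * a) ^ d                               ≡⟨ sym (*-identityˡ _) ⟩
      1 * (4 * Δ * (7 * a) ^ d)                         ≡⟨ cong (_* (4 * Δ * (7 * a) ^ d)) (sym (⟦⟧-yes (Bad? ⊥ ×-dec (⊥ ⊆? A)) (bad , ⊥⊆))) ⟩
      badWithin A Bad? ⊥ * (4 * Δ * (7 * a) ^ d)        ≤⟨ few z≤n ⟩
      1 * (5 * b) ^ d                                   ≡⟨ *-identityˡ _ ⟩
      (5 * b) ^ d                                       ≤⟨ ^-monoˡ-≤ d (*-mono-≤ (toWitness {a? = 5 ≤? 7} _) b≤a) ⟩
      (7 * a) ^ d                                       ∎)
      where
      open ≤-Reasoning
      a≢0 : NonZero a
      a≢0 = >-nonZero (<-≤-trans (>-nonZero⁻¹ b) b≤a)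

    count-⊥>0 : count ⊥ > 0
    count-⊥>0 = subst (_> 0) (sym (trans (∑-cong (words b m) λ χ → ⟦⟧-yes (Valid? ⊥ χ) (valid χ)) (∑-words-1 b m))) (m^n>0 b m)
      where
      valid : ∀ χ → Valid ⊥ χ
      valid χ = (λ _ _ v∈⊥ → contradiction v∈⊥ ∉⊥) ,
        λ u N⊆⊥ bad → ¬Bad-⊥ (Bad-mono (image-⊆ (decode g χ) λ v∈N → contradiction (N⊆⊥ v∈N) ∉⊥) bad)

    ∃-valid : ∃[ χ ] Valid ⊤ χ
    ∃-valid with χ , χ>0 ← ∑>0⇒∃ (words b m) (λ χ → ⟦ Valid? ⊤ χ ⟧) (count-⊤>0 count-⊥>0) = χ , ⟦⟧>0 (Valid? ⊤ χ) χ>0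

-- Application to common out-neighbourhoods in a tournament

lemma2p4 : ∀ {m k n : ℕ} (D : BipartiteDigraph m k) → Δ⁻ D ≥ 1 →
    (a b c : ℕ) (δ : ℝ) → fromℕ 0 <ʳ δ → a ≥ b → b ≥ 32 * m →
    δ ≤ʳ (2⁻¹ᐟ² *ʳ (fromℕ b /ʳ a)) ^ʳ Δ⁻ D /ʳ (4 * Δ⁺ D * Δ⁻ D) →
    (T : Tournament n) (A B : Subset n) → ∣ A ∣ ≡ a →
    AllButFraction δ (λ S → c ≤? ∣ N⁺ T S ∩ B ∣) (subsetsOfSize (Δ⁻ D) A) →
    (f : Fin m → Subset n) → (∀ v → f v ⊆ A) → (∀ v → ∣ f v ∣ ≥ b) →
    ∃[ φ ] Injective _≡_ _≡_ φ
    × (∀ v → φ v ∈ A)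
    × (∀ v → φ v ∈ f v)
    × (∀ u → ∣ N⁺ T (image φ (inNbhd D u)) ∩ B ∣ ≥ c)
lemma2p4 {m} {k} {n} D Δ⁻≥1 a b c δ _ b≤a 32m≤b δ≤ T A B refl fraction f f⊆A b≤f =
  decode g χ ,
  (λ {v} {w} → inj v w ∈⊤ ∈⊤) ,
  (λ v → f⊆A v (g∈f v (lookup χ v))) ,
  (λ v → g∈f v (lookup χ v)) ,
  λ u → decidable-stable (c ≤? ∣ N⁺ T (image (decode g χ) (inNbhd D u)) ∩ B ∣) (good u (λ _ → ∈⊤))
  where
  d Δ : ℕ
  d = Δ⁻ D
  Δ = Δ⁺ D

  Bad : Subset n → Set
  Bad S = ¬ (c ≤ ∣ N⁺ T S ∩ B ∣)

  Bad? : Decidable Bad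
  Bad? S = ¬? (c ≤? ∣ N⁺ T S ∩ B ∣)

  -- Enlarging a set shrinks its common out-neighbourhood.
  Bad-mono : ∀ {S S′} → S ⊆ S′ → Bad S → Bad S′
  Bad-mono {S} {S′} S⊆S′ bad c≤ = bad (≤-trans c≤ (p⊆q⇒∣p∣≤∣q∣ λ x∈ →
    let x∈N , x∈B = x∈p∩q⁻ (N⁺ T S′) B x∈ in x∈p∩q⁺ (N⁺-antitone T S⊆S′ x∈N , x∈B)))

  g : Fin m → Fin b → Fin n
  g v = proj₁ (enumerate (f v) b (b≤f v))

  g-inj : ∀ v → Injective _≡_ _≡_ (g v)
  g-inj v = proj₁ (proj₂ (enumerate (f v) b (b≤f v)))

  g∈f : ∀ v x → g v x ∈ f v
  g∈f v = proj₂ (proj₂ (enumerate (f v) b (b≤f v)))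

  m≤b : m ≤ b
  m≤b = ≤-trans (m≤n*m m 32) 32m≤b

  m>0 : m > 0
  m>0 = ≤-trans Δ⁻≥1 (Δ⁻≤∣V₁∣ D)

  instance
    d≢0 : NonZero d
    d≢0 = >-nonZero Δ⁻≥1
    Δ≢0 : NonZero Δ
    Δ≢0 = >-nonZero (Δ⁻>0⇒Δ⁺>0 D Δ⁻≥1)
    m≢0 : NonZero m
    m≢0 = >-nonZero m>0
    b≢0 : NonZero b
    b≢0 = >-nonZero (≤-trans m>0 m≤b)
    a≢0 : NonZero ∣ A ∣
    a≢0 = >-nonZero (≤-trans m>0 (≤-trans m≤b b≤a))

  few-sets : length (filter Bad? (subsetsOfSize d A)) * (4 * Δ * (7 * ∣ A ∣) ^ d)
           ≤ length (subsetsOfSize d A) * (5 * b) ^ d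
  few-sets = ≤-trans
    -- Passes from the factor `4 * Δ * d` to `4 * Δ`, by `d ≥ 1`.
    (*-monoʳ-≤ (length (filter Bad? (subsetsOfSize d A))) (*-monoˡ-≤ ((7 * ∣ A ∣) ^ d) (m≤m*n (4 * Δ) d)))
    (few-bad {δ} (length (filter Bad? (subsetsOfSize d A))) (length (subsetsOfSize d A)) b ∣ A ∣ (4 * Δ * d) d {{it}} {{m*n≢0 (4 * Δ) d {{m*n≢0 4 Δ}}}} δ≤ fraction)

  few : ∀ {j} → j ≤ d → extensions (badWithin A Bad?) j ⊥ * (4 * Δ * (7 * ∣ A ∣) ^ d) ≤ ∣ A ∣ ^ j * (5 * b) ^ d
  few = bad-extensions-bound A Bad? Bad-mono (4 * Δ * (7 * ∣ A ∣) ^ d) ((5 * b) ^ d) d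
    (≤-trans (Δ⁻≤∣V₁∣ D) (≤-trans m≤b b≤a)) few-sets

  solution : ∃[ χ ] Valid D A Bad? Bad-mono g ⊤ χ
  solution = ∃-valid D A Bad? Bad-mono g ∣ A ∣ d Δ g-inj (λ v x → f⊆A v (g∈f v x)) b≤a 32m≤b
    (≤maximum λ u → ∣ inNbhd D u ∣) (≤maximum λ v → ∣ outNbhd D v ∣) few

  χ : Vec (Fin b) m
  χ = proj₁ solution

  inj : ∀ v w → v ∈ ⊤ → w ∈ ⊤ → decode g χ v ≡ decode g χ w → v ≡ w
  inj = proj₁ (proj₂ solution)

  good : ∀ u → inNbhd D u ⊆ ⊤ → ¬ Bad (image (decode g χ) (inNbhd D u))
  good = proj₂ (proj₂ solution)
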